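{- There is a non-adaptive $O(1)$-approximation algorithm for the Stoch-Reward $k$-TSP problem. That is, there is an algorithm which, given an instance, outputs a fixed ordering (tour) of vertices starting at the root, which is then traversed until the collected reward reaches $k$, such that the expected length travelled is at most a universal constant times the expected tour length of the optimal adaptive policy.
   Context: Stoch-Reward $k$-TSP: We are given a finite metric $(V,d)$ with a designated vertex $\mathsf{root}\in V$, a target $k\in\mathbb{Z}_{\ge 0}$, and for each vertex $v\in V$ an independent integral nonnegative random reward $R_v\in\mathbb{Z}_{\ge 0}$ whose (discrete) distribution is given explicitly as input. The actual value of $R_v$ is revealed only when $v$ is visited. The goal is to find a tour $\Pi$ originating at $\mathsf{root}$ that collects at least $k$ reward (i.e. $\sum_{v\in\Pi}R_v\ge k$) while minimizing the expected tour length. An adaptive algorithm may choose the next vertex to visit depending on the already revealed rewards; a non-adaptive algorithm specifies an ordered list of vertices in advance and visits them in this order until a stopping criterion (here: reward $k$ reached) is met. An algorithm is an $\alpha$-approximation if its expected objective is at most $\alpha$ times the expected objective of the optimal adaptive algorithm.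
   Formalization: The distances of the finite metric and the probabilities of the reward distributions are taken to be rational numbers instead of real numbers. -}

module Defs where

open import Data.Nat as ℕ using (ℕ; zero; suc)
open import Data.Fin using (Fin)
open import Data.List using (List; []; _∷_; foldr)
open import Data.Product using (_×_; _,_; proj₁; proj₂)
open import Data.Sum using (_⊎_)
open import Data.Empty using (⊥)
open import Data.Rational as ℚ using (ℚ; 0ℚ; 1ℚ; _+_; _*_)
open import Data.List.Membership.Propositional using (_∈_; _∉_)
open import Relation.Binary.PropositionalEquality using (_≡_)
open import Relation.Nullary using (yes; no)

record IsMetric {n : ℕ} (d : Fin n → Fin n → ℚ) : Set where
  field
    nonneg    : ∀ x y → 0ℚ ℚ.≤ d x y
    zero-diag : ∀ x → d x x ≡ 0ℚ
    symmetric : ∀ x y → d x y ≡ d y x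
    triangle  : ∀ x y z → d x z ℚ.≤ d x y + d y z

-- An explicitly given discrete distribution on ℤ≥0:
-- a finite list of (value , probability) pairs.
Dist : Set
Dist = List (ℕ × ℚ)

totalProb : Dist → ℚ
totalProb = foldr (λ vp acc → proj₂ vp + acc) 0ℚ

expect : Dist → (ℕ → ℚ) → ℚ
expect D f = foldr (λ vp acc → proj₂ vp * f (proj₁ vp) + acc) 0ℚ D

record Instance (n : ℕ) : Set where
  field
    root      : Fin n
    d         : Fin n → Fin n → ℚ
    isMetric  : IsMetric d
    k         : ℕ
    dist      : Fin n → Dist
    prob-nonneg : ∀ v {rp} → rp ∈ dist v → 0ℚ ℚ.≤ proj₂ rp
    prob-sum    : ∀ v → totalProb (dist v) ≡ 1ℚ

-- Adaptive policies: decision trees. 'visit v f' goes to vertex v,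
-- observes R_v = r and continues with policy f r.
data Policy (n : ℕ) : Set where
  stop  : Policy n
  visit : Fin n → (ℕ → Policy n) → Policy n

module _ {n : ℕ} (I : Instance n) where
  open Instance I

  -- Expected length travelled by a policy started at vertex 'cur'.
  -- (Rewards are independent and each vertex is visited at most once on
  -- every branch of a valid policy, so this recursion computes the
  -- expectation over the product distribution.)
  expCostFrom : Fin n → Policy n → ℚ
  expCostFrom cur stop        = 0ℚ
  expCostFrom cur (visit v f) = d cur v + expect (dist v) (λ r → expCostFrom v (f r))

  expCost : Policy n → ℚ
  expCost = expCostFrom root

  ValidFrom : ℕ → List (Fin n) → Policy n → Set
  ValidFrom acc vs stop        = (k ℕ.≤ acc) ⊎ (∀ v → v ∈ vs)
  ValidFrom acc vs (visit v f) =
    (acc ℕ.< k) × (v ∉ vs) × (∀ {rp} → rp ∈ dist v → ValidFrom (acc ℕ.+ proj₁ rp) (v ∷ vs) (f (proj₁ rp)))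

  ValidPolicy : Policy n → Set
  ValidPolicy = ValidFrom 0 []

  nonAdaptiveFrom : ℕ → List (Fin n) → Policy n
  nonAdaptiveFrom acc []       = stop
  nonAdaptiveFrom acc (v ∷ σ) with k ℕ.≤? acc
  ... | yes _ = stop
  ... | no  _ = visit v (λ r → nonAdaptiveFrom (acc ℕ.+ r) σ)

  nonAdaptive : List (Fin n) → Policy n
  nonAdaptive = nonAdaptiveFrom 0

{-# OPTIONS --safe #-}
module Submission where

-- The adaptive optimum is compared with fixed orders by sampling. Let P be the path of a decision tree π on
-- rewards r, and for a scale m let x < 1 be such that x^(m+1) lies between ½ and ⅔. Replacing the rewards along P by
-- fresh ones changes 1 − E x^reward by a factor at most 2 (decoupling). Draw independent paths P₁, …, P_s of π besides P.
-- Either the union U of the Pᵢ carries reward more than m outside P with good probability, or some union V of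
-- such paths leaves little to gain at scale m, so that P carries reward at most m outside V with good
-- probability. Since r(U ∪ V) ≥ r(P) + r(U ∖ P) − r(P ∖ V), the first scale m at which the second alternative
-- occurs yields boundedly many paths which together reach k with constant probability whenever π does.
--
-- Conditioning on the rewards already seen, such a round turns the failure probability u into at most ¾ u + q,
-- where q is the probability that the optimum, cut at length B, fails. Rounds with budgets B, β B, β² B, … for
-- β = 5/4 < 4/3 then cost O(1) times the optimum. The algorithm minimises the expected cost over all orders.

open import Defs
open import Data.Bool using (true; false; if_then_else_)
import Data.Bool.Properties as Boolₚ
open import Data.Empty using (⊥-elim)
open import Data.Fin using (Fin; zero; suc)
import Data.Fin.Properties as Finₚ
open import Data.Fin.Subset using (Subset; _∪_; ⊥)
open import Data.Fin.Subset.Properties using (∪-identityˡ; ∪-identityʳ; ∪-assoc; ∪-comm)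
import Data.Integer as ℤ
import Data.Integer.Properties as ℤₚ
open import Data.List using (List; []; _∷_; _++_; allFin; cartesianProductWith; concat; filter; length)
open import Data.List.Membership.Propositional using (_∈_)
open import Data.List.Membership.Propositional.Properties
  using (∈-allFin; ∈-cartesianProductWith⁺; ∈-filter⁺; ∈-++⁺ʳ)
open import Data.List.Membership.Propositional.Properties.WithK using (unique∧set⇒bag)
import Data.List.Membership.DecPropositional as DecMembership
import Data.List.Properties as Listₚ
open import Data.List.Relation.Binary.BagAndSetEquality using (∼bag⇒↭)
open import Data.List.Relation.Binary.Permutation.Propositional.Properties using (↭-length)
open import Data.List.Relation.Unary.All as All using (All; []; _∷_)
import Data.List.Relation.Unary.All.Properties as Allₚ
open import Data.List.Relation.Unary.AllPairs using ([]; _∷_)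
open import Data.List.Relation.Unary.Any using (here; there)
open import Data.List.Relation.Unary.Unique.Propositional using (Unique)
import Data.List.Relation.Unary.Unique.DecPropositional as DecUnique
open import Data.List.Relation.Unary.Unique.Propositional.Properties using (allFin⁺)
open import Data.Nat as ℕ using (ℕ; zero; suc)
open import Data.Nat.Coprimality using (1-coprimeTo) renaming (sym to coprime-sym)
import Data.Nat.Properties as ℕₚ
open import Data.Product using (Σ; ∃; _×_; _,_; proj₁; proj₂)
open import Data.Rational hiding (∣_∣)
open import Data.Rational.Properties
import Data.Rational.Unnormalised as ℚᵘ
import Data.Rational.Unnormalised.Properties as ℚᵘₚ
open import Data.Sum using (_⊎_; inj₁; inj₂)
open import Data.Unit using (⊤; tt)
open import Data.Vec using (Vec; []; _∷_; lookup; zipWith; _[_]≔_)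
open import Function using (_∘_; case_of_; mk⇔)
open import Relation.Binary.Bundles using (module DecTotalOrder)
open import Data.List.Extrema (DecTotalOrder.totalOrder ≤-decTotalOrder)
  using (argmin; argmin-all; argmin-sel; f[argmin]≤f[⊤]; f[argmin]≤f[xs])
open import Relation.Binary.PropositionalEquality
open import Relation.Nullary using (Dec; yes; no; ¬_)
open import Relation.Nullary.Decidable using (dec⇒maybe; from-yes; _×-dec_)
open import Relation.Unary using (Decidable)
open import Tactic.RingSolver using (solve-∀)
open import Tactic.RingSolver.Core.AlmostCommutativeRing using (AlmostCommutativeRing; fromCommutativeRing)

-- Rational inequalities and powers.

ℚ-ring : AlmostCommutativeRing _ _
ℚ-ring = fromCommutativeRing +-*-commutativeRing (λ x → dec⇒maybe (0ℚ ≟ x))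

diff≥0 : ∀ {p q} → p ≤ q → 0ℚ ≤ q - p
diff≥0 {p} {q} p≤q = subst (_≤ q - p) (+-inverseʳ p) (+-monoˡ-≤ (- p) p≤q)

-- Linear inequalities are proved by exhibiting rhs − lhs as an evidently nonnegative e.
≤-by : ∀ {l r e} → 0ℚ ≤ e → r ≡ l + e → l ≤ r
≤-by {l} {r} {e} 0≤e eq = subst₂ _≤_ (+-identityʳ l) (sym eq) (+-monoʳ-≤ l 0≤e)

infixl 6 _⊕_
infixl 7 _⊛_

_⊕_ : ∀ {p q} → 0ℚ ≤ p → 0ℚ ≤ q → 0ℚ ≤ p + q
_⊕_ = +-mono-≤

*-monoˡ-≤ : ∀ {c p q} → 0ℚ ≤ c → p ≤ q → c * p ≤ c * q
*-monoˡ-≤ {c} 0≤c = *-monoˡ-≤-nonNeg c {{nonNegative 0≤c}}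

*-monoʳ-≤ : ∀ {c p q} → 0ℚ ≤ c → p ≤ q → p * c ≤ q * c
*-monoʳ-≤ {c} 0≤c = *-monoʳ-≤-nonNeg c {{nonNegative 0≤c}}

_⊛_ : ∀ {p q} → 0ℚ ≤ p → 0ℚ ≤ q → 0ℚ ≤ p * q
_⊛_ {p} {q} 0≤p 0≤q = subst (_≤ p * q) (*-zeroʳ p) (*-monoˡ-≤ 0≤p 0≤q)

0≤1 : 0ℚ ≤ 1ℚ
0≤1 = nonNegative⁻¹ 1ℚ

opaque
  2ℚ 3ℚ : ℚ
  2ℚ = 1ℚ + 1ℚ
  3ℚ = 1ℚ + 1ℚ + 1ℚ

  0≤2 : 0ℚ ≤ 2ℚ
  0≤2 = 0≤1 ⊕ 0≤1

  0<2 : 0ℚ < 2ℚ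
  0<2 = positive⁻¹ (1ℚ + 1ℚ)

  0≤3 : 0ℚ ≤ 3ℚ
  0≤3 = 0≤1 ⊕ 0≤1 ⊕ 0≤1

-- The library's power over a semiring carries the ring structure of ℚ as a parameter, which is slow to normalise.
infixr 8 _^_

_^_ : ℚ → ℕ → ℚ
x ^ zero  = 1ℚ
x ^ suc n = x * x ^ n

^-homo-* : ∀ x m n → x ^ (m ℕ.+ n) ≡ x ^ m * x ^ n
^-homo-* x zero    n = sym (*-identityˡ (x ^ n))
^-homo-* x (suc m) n = trans (cong (x *_) (^-homo-* x m n)) (sym (*-assoc x (x ^ m) (x ^ n)))

^-nonneg : ∀ {x} n → 0ℚ ≤ x → 0ℚ ≤ x ^ n
^-nonneg zero    0≤x = 0≤1
^-nonneg (suc n) 0≤x = 0≤x ⊛ ^-nonneg n 0≤x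

*≤1 : ∀ {p q} → 0ℚ ≤ q → p ≤ 1ℚ → q ≤ 1ℚ → p * q ≤ 1ℚ
*≤1 {p} {q} 0≤q p≤1 q≤1 = ≤-trans (*-monoʳ-≤ 0≤q p≤1) (subst (_≤ 1ℚ) (sym (*-identityˡ q)) q≤1)

^-≤1 : ∀ {x} n → 0ℚ ≤ x → x ≤ 1ℚ → x ^ n ≤ 1ℚ
^-≤1 zero    0≤x x≤1 = ≤-refl
^-≤1 (suc n) 0≤x x≤1 = *≤1 (^-nonneg n 0≤x) x≤1 (^-≤1 n 0≤x x≤1)

^-anti : ∀ {x m n} → 0ℚ ≤ x → x ≤ 1ℚ → m ℕ.≤ n → x ^ n ≤ x ^ m
^-anti {n = n} 0≤x x≤1 ℕ.z≤n = ^-≤1 n 0≤x x≤1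
^-anti 0≤x x≤1 (ℕ.s≤s m≤n) = *-monoˡ-≤ 0≤x (^-anti 0≤x x≤1 m≤n)

-- Indicators of decidable events.

⟦_⟧ : ∀ {p} {P : Set p} → Dec P → ℚ
⟦ yes _ ⟧ = 1ℚ
⟦ no _ ⟧  = 0ℚ

module _ {p} {P : Set p} where
  ⟦⟧-nonneg : (P? : Dec P) → 0ℚ ≤ ⟦ P? ⟧
  ⟦⟧-nonneg (yes _) = 0≤1
  ⟦⟧-nonneg (no _)  = ≤-refl

  ⟦⟧-≤1 : (P? : Dec P) → ⟦ P? ⟧ ≤ 1ℚ
  ⟦⟧-≤1 (yes _) = ≤-refl
  ⟦⟧-≤1 (no _)  = 0≤1

  ⟦⟧-true : (P? : Dec P) → P → ⟦ P? ⟧ ≡ 1ℚ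
  ⟦⟧-true (yes _) _ = refl
  ⟦⟧-true (no ¬p) p = ⊥-elim (¬p p)

  ⟦⟧-false : (P? : Dec P) → ¬ P → ⟦ P? ⟧ ≡ 0ℚ
  ⟦⟧-false (yes p) ¬p = ⊥-elim (¬p p)
  ⟦⟧-false (no _)  _  = refl

  ⟦⟧-bound : (P? : Dec P) {x : ℚ} → 0ℚ ≤ x → (P → 1ℚ ≤ x) → ⟦ P? ⟧ ≤ x
  ⟦⟧-bound (yes p) _   h = h p
  ⟦⟧-bound (no _)  0≤x _ = 0≤x

⟦⟧-mono : ∀ {p q} {P : Set p} {Q : Set q} (P? : Dec P) (Q? : Dec Q) → (P → Q) → ⟦ P? ⟧ ≤ ⟦ Q? ⟧
⟦⟧-mono P? Q? f = ⟦⟧-bound P? (⟦⟧-nonneg Q?) (λ p → ≤-reflexive (sym (⟦⟧-true Q? (f p))))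

⟦⟧-union : ∀ {a b c d} {A : Set a} {B : Set b} {C : Set c} {T : Set d}
  (T? : Dec T) (A? : Dec A) (B? : Dec B) (C? : Dec C) → (¬ A → ¬ B → ¬ C → ¬ T) →
  ⟦ T? ⟧ ≤ ⟦ A? ⟧ + ⟦ B? ⟧ + ⟦ C? ⟧
⟦⟧-union T? (yes _) B? C? h =
  ≤-by (⟦⟧-nonneg B? ⊕ ⟦⟧-nonneg C? ⊕ diff≥0 (⟦⟧-≤1 T?)) (lemma ⟦ B? ⟧ ⟦ C? ⟧ ⟦ T? ⟧)
  where
  lemma : ∀ b c t → 1ℚ + b + c ≡ t + (b + c + (1ℚ - t))
  lemma = solve-∀ ℚ-ring
⟦⟧-union T? (no _) (yes _) C? h =
  ≤-by (⟦⟧-nonneg C? ⊕ diff≥0 (⟦⟧-≤1 T?)) (lemma ⟦ C? ⟧ ⟦ T? ⟧)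
  where
  lemma : ∀ c t → 0ℚ + 1ℚ + c ≡ t + (c + (1ℚ - t))
  lemma = solve-∀ ℚ-ring
⟦⟧-union T? (no _)  (no _)  (yes _) h = ⟦⟧-≤1 T?
⟦⟧-union T? (no ¬a) (no ¬b) (no ¬c) h = ≤-reflexive (⟦⟧-false T? (h ¬a ¬b ¬c))

record IsProb (D : Dist) : Set where
  field
    nonneg : ∀ {rp} → rp ∈ D → 0ℚ ≤ proj₂ rp
    total  : totalProb D ≡ 1ℚ

-- Expectation over one reward

expect-cong-∈ : ∀ D {f g} → (∀ {rp} → rp ∈ D → f (proj₁ rp) ≡ g (proj₁ rp)) → expect D f ≡ expect D g
expect-cong-∈ []            h = refl
expect-cong-∈ ((a , p) ∷ D) h = cong₂ (λ x y → p * x + y) (h (here refl)) (expect-cong-∈ D (h ∘ there))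

expect-cong : ∀ D {f g} → (∀ a → f a ≡ g a) → expect D f ≡ expect D g
expect-cong D h = expect-cong-∈ D (λ {rp} _ → h (proj₁ rp))

expect-mono : ∀ D {f g} → (∀ {rp} → rp ∈ D → 0ℚ ≤ proj₂ rp) →
  (∀ {rp} → rp ∈ D → f (proj₁ rp) ≤ g (proj₁ rp)) → expect D f ≤ expect D g
expect-mono []            nn h = ≤-refl
expect-mono ((a , p) ∷ D) nn h =
  +-mono-≤ (*-monoˡ-≤ (nn (here refl)) (h (here refl))) (expect-mono D (nn ∘ there) (h ∘ there))

expect-+ : ∀ D f g → expect D (λ a → f a + g a) ≡ expect D f + expect D g
expect-+ []            f g = refl
expect-+ ((a , p) ∷ D) f g =
  trans (cong (_+_ (p * (f a + g a))) (expect-+ D f g)) (lemma p (f a) (g a) (expect D f) (expect D g))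
  where
  lemma : ∀ p x y u v → p * (x + y) + (u + v) ≡ (p * x + u) + (p * y + v)
  lemma = solve-∀ ℚ-ring

expect-* : ∀ D c f → expect D (λ a → c * f a) ≡ c * expect D f
expect-* []            c f = sym (*-zeroʳ c)
expect-* ((a , p) ∷ D) c f =
  trans (cong (_+_ (p * (c * f a))) (expect-* D c f)) (lemma p c (f a) (expect D f))
  where
  lemma : ∀ p c x u → p * (c * x) + c * u ≡ c * (p * x + u)
  lemma = solve-∀ ℚ-ring

expect-total : ∀ D c → expect D (λ _ → c) ≡ totalProb D * c
expect-total []            c = sym (*-zeroˡ c)
expect-total ((a , p) ∷ D) c =
  trans (cong (_+_ (p * c)) (expect-total D c)) (sym (*-distribʳ-+ c p (totalProb D)))

expect-const : ∀ {D} → IsProb D → ∀ c → expect D (λ _ → c) ≡ c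
expect-const {D} pr c =
  trans (expect-total D c) (trans (cong (_* c) (IsProb.total pr)) (*-identityˡ c))

expect-swap : ∀ D D′ (f : ℕ → ℕ → ℚ) →
  expect D (λ a → expect D′ (f a)) ≡ expect D′ (λ b → expect D (λ a → f a b))
expect-swap []            D′ f = sym (trans (expect-total D′ 0ℚ) (*-zeroʳ (totalProb D′)))
expect-swap ((a , p) ∷ D) D′ f = begin
  p * expect D′ (f a) + expect D (λ a → expect D′ (f a))
    ≡⟨ cong₂ _+_ (sym (expect-* D′ p (f a))) (expect-swap D D′ f) ⟩
  expect D′ (λ b → p * f a b) + expect D′ (λ b → expect D (λ a → f a b))
    ≡⟨ expect-+ D′ _ _ ⟨
  expect D′ (λ b → p * f a b + expect D (λ a → f a b)) ∎
  where open ≡-Reasoning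

-- The least listed value is at most the average; the list is nonempty because its weights sum to 1.
expect-attains : ∀ {D} → IsProb D → ∀ f → ∃ λ rp → rp ∈ D × f (proj₁ rp) ≤ expect D f
expect-attains {[]} pr f with () ← IsProb.total pr
expect-attains {x ∷ D} pr f = m , m∈ , subst (_≤ expect (x ∷ D) f) (expect-const pr (f (proj₁ m)))
  (expect-mono (x ∷ D) (IsProb.nonneg pr) λ { (here refl) → f[argmin]≤f[⊤] {f = f ∘ proj₁} x D
                                            ; (there a∈D) → All.lookup (f[argmin]≤f[xs] {f = f ∘ proj₁} x D) a∈D })
  where
  m = argmin (f ∘ proj₁) x D
  m∈ : m ∈ x ∷ D
  m∈ with argmin-sel (f ∘ proj₁) x D
  ... | inj₁ eq rewrite eq = here refl
  ... | inj₂ m∈D = there m∈D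

-- Expectation over all rewards

E : ∀ {n} → (Fin n → Dist) → (Vec ℕ n → ℚ) → ℚ
E {zero}  D G = G []
E {suc n} D G = expect (D zero) (λ a → E (D ∘ suc) (λ r → G (a ∷ r)))

-- Being listed is what counts, whatever the weight: validity of a policy speaks about the branches
-- of exactly the listed values.
Supp : ∀ {n} → (Fin n → Dist) → Vec ℕ n → Set
Supp D r = ∀ v → ∃ λ p → (lookup r v , p) ∈ D v

Supp-∷ : ∀ {n} (D : Fin (suc n) → Dist) {rp r} → rp ∈ D zero → Supp (D ∘ suc) r → Supp D (proj₁ rp ∷ r)
Supp-∷ D {_ , p} a∈ s zero    = p , a∈
Supp-∷ D         a∈ s (suc v) = s v

E-cong : ∀ {n} (D : Fin n → Dist) {f g} → (∀ r → f r ≡ g r) → E D f ≡ E D g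
E-cong {zero}  D h = h []
E-cong {suc n} D h = expect-cong (D zero) (λ a → E-cong (D ∘ suc) (λ r → h (a ∷ r)))

E-+ : ∀ {n} (D : Fin n → Dist) f g → E D (λ r → f r + g r) ≡ E D f + E D g
E-+ {zero}  D f g = refl
E-+ {suc n} D f g =
  trans (expect-cong (D zero) (λ a → E-+ (D ∘ suc) _ _)) (expect-+ (D zero) _ _)

E-+₃ : ∀ {n} (D : Fin n → Dist) f g h → E D (λ r → f r + g r + h r) ≡ E D f + E D g + E D h
E-+₃ D f g h = trans (E-+ D (λ r → f r + g r) h) (cong (_+ E D h) (E-+ D f g))

E-* : ∀ {n} (D : Fin n → Dist) c f → E D (λ r → c * f r) ≡ c * E D f
E-* {zero}  D c f = refl
E-* {suc n} D c f =
  trans (expect-cong (D zero) (λ a → E-* (D ∘ suc) c _)) (expect-* (D zero) c _)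

E-expect-swap : ∀ {n} (D : Fin n → Dist) D′ (f : Vec ℕ n → ℕ → ℚ) →
  E D (λ r → expect D′ (f r)) ≡ expect D′ (λ a → E D (λ r → f r a))
E-expect-swap {zero}  D D′ f = refl
E-expect-swap {suc n} D D′ f =
  trans (expect-cong (D zero) (λ a → E-expect-swap (D ∘ suc) D′ (λ r → f (a ∷ r)))) (expect-swap (D zero) D′ _)

E-swap : ∀ {m n} (D : Fin m → Dist) (D′ : Fin n → Dist) (f : Vec ℕ m → Vec ℕ n → ℚ) →
  E D (λ r → E D′ (f r)) ≡ E D′ (λ r′ → E D (λ r → f r r′))
E-swap {zero}  D D′ f = refl
E-swap {suc m} D D′ f =
  trans (expect-cong (D zero) (λ a → E-swap (D ∘ suc) D′ (λ r → f (a ∷ r))))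
        (sym (E-expect-swap D′ (D zero) _))

mix : ∀ {n} → Subset n → Vec ℕ n → Vec ℕ n → Vec ℕ n
mix []          []      []      = []
mix (true  ∷ S) (a ∷ r) (b ∷ s) = a ∷ mix S r s
mix (false ∷ S) (a ∷ r) (b ∷ s) = b ∷ mix S r s

-- The law of the rewards conditioned on `S` showing `ρ`. It is again a product, so a round can be
-- played under it.
pin : ∀ {n} → Subset n → Vec ℕ n → (Fin n → Dist) → Fin n → Dist
pin S ρ D v = if lookup S v then (lookup ρ v , 1ℚ) ∷ [] else D v

E-pin : ∀ {n} (S : Subset n) ρ D (G : Vec ℕ n → ℚ) → (∀ v → IsProb (D v)) →
  E (pin S ρ D) G ≡ E D (λ r → G (mix S ρ r))
E-pin []          []      D G pr = refl
E-pin (true  ∷ S) (a ∷ ρ) D G pr = begin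
  1ℚ * E (pin S ρ (D ∘ suc)) (λ r → G (a ∷ r)) + 0ℚ
    ≡⟨ trans (+-identityʳ _) (*-identityˡ _) ⟩
  E (pin S ρ (D ∘ suc)) (λ r → G (a ∷ r))
    ≡⟨ E-pin S ρ (D ∘ suc) (λ r → G (a ∷ r)) (pr ∘ suc) ⟩
  E (D ∘ suc) (λ r → G (a ∷ mix S ρ r))
    ≡⟨ expect-const (pr zero) _ ⟨
  E D (λ r → G (mix (true ∷ S) (a ∷ ρ) r)) ∎
  where open ≡-Reasoning
E-pin (false ∷ S) (a ∷ ρ) D G pr =
  expect-cong (D zero) (λ b → E-pin S ρ (D ∘ suc) (λ r → G (b ∷ r)) (pr ∘ suc))

pin-isProb : ∀ {n} (S : Subset n) ρ {D} → (∀ v → IsProb (D v)) → ∀ v → IsProb (pin S ρ D v)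
pin-isProb S ρ pr v with lookup S v
... | true  = record { nonneg = λ { (here refl) → 0≤1 } ; total = refl }
... | false = pr v

E-mono-Supp : ∀ {n} {D : Fin n → Dist} {f g} → (∀ v → IsProb (D v)) →
  (∀ r → Supp D r → f r ≤ g r) → E D f ≤ E D g
E-mono-Supp {zero}      pr h = h [] (λ ())
E-mono-Supp {suc n} {D} pr h = expect-mono (D zero) (IsProb.nonneg (pr zero))
  (λ {rp} a∈ → E-mono-Supp (pr ∘ suc) (λ r s → h (proj₁ rp ∷ r) (Supp-∷ D a∈ s)))

E-mono : ∀ {n} {D : Fin n → Dist} {f g} → (∀ v → IsProb (D v)) → (∀ r → f r ≤ g r) → E D f ≤ E D g
E-mono pr h = E-mono-Supp pr (λ r _ → h r)

E-mono-* : ∀ {n} {D : Fin n → Dist} {f} (g : Vec ℕ n → ℚ) {c t} → (∀ v → IsProb (D v)) → 0ℚ ≤ c →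
  (∀ r → f r ≤ c * g r) → E D g ≤ t → E D f ≤ c * t
E-mono-* {D = D} {f} g {c} pr 0≤c h Eg≤t =
  ≤-trans (subst (E D f ≤_) (E-* D c g) (E-mono pr h)) (*-monoˡ-≤ 0≤c Eg≤t)

E-const : ∀ {n} {D : Fin n → Dist} → (∀ v → IsProb (D v)) → ∀ c → E D (λ _ → c) ≡ c
E-const {zero}      pr c = refl
E-const {suc n} {D} pr c = trans (expect-cong (D zero) (λ _ → E-const (pr ∘ suc) c)) (expect-const (pr zero) c)

-- Independence of coordinate `v`: redrawing it separately leaves the joint law as it is.
E-resample : ∀ {n} {D : Fin n → Dist} → (∀ v → IsProb (D v)) → ∀ v (G : Vec ℕ n → ℚ) →
  E D G ≡ expect (D v) (λ a → E D (λ r → G (r [ v ]≔ a)))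
E-resample {suc n} {D} pr zero G =
  expect-cong (D zero) (λ a → sym (expect-const (pr zero) _))
E-resample {suc n} {D} pr (suc v) G =
  trans (expect-cong (D zero) (λ b → E-resample (pr ∘ suc) v (λ r → G (b ∷ r))))
        (expect-swap (D zero) (D (suc v)) _)

-- Two independent samples glued along `S` form another sample. With `E-pin` this is the law of
-- total expectation for conditioning on `S`.
E-mix : ∀ {n} (S : Subset n) {D} → (∀ v → IsProb (D v)) → ∀ (G : Vec ℕ n → ℚ) →
  E D (λ r → E D (λ r′ → G (mix S r r′))) ≡ E D G
E-mix []          pr G = refl
E-mix (true ∷ S) {D} pr G = expect-cong (D zero) λ a →
  trans (E-cong (D ∘ suc) (λ r → expect-const (pr zero) _)) (E-mix S (pr ∘ suc) (λ r → G (a ∷ r)))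
E-mix (false ∷ S) {D} pr G = begin
  expect (D zero) (λ _ → E D′ (λ r → expect (D zero) (λ b → E D′ (λ r′ → G (b ∷ mix S r r′)))))
    ≡⟨ expect-const (pr zero) _ ⟩
  E D′ (λ r → expect (D zero) (λ b → E D′ (λ r′ → G (b ∷ mix S r r′))))
    ≡⟨ E-expect-swap D′ (D zero) _ ⟩
  expect (D zero) (λ b → E D′ (λ r → E D′ (λ r′ → G (b ∷ mix S r r′))))
    ≡⟨ expect-cong (D zero) (λ b → E-mix S (pr ∘ suc) (λ r → G (b ∷ r))) ⟩
  E D G ∎
  where
  open ≡-Reasoning
  D′ = D ∘ suc

-- Opaque, so that a with-abstraction over a witness does not unfold the search for it.
opaque
  E-attains-≤ : ∀ {n} {D : Fin n → Dist} → (∀ v → IsProb (D v)) → ∀ f → ∃ λ r → Supp D r × f r ≤ E D f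
  E-attains-≤ {zero} pr f = [] , (λ ()) , ≤-refl
  E-attains-≤ {suc n} {D} pr f
    with expect-attains (pr zero) (λ a → E (D ∘ suc) (λ r → f (a ∷ r)))
  ... | (a , p) , a∈ , fa≤ with E-attains-≤ (pr ∘ suc) (λ r → f (a ∷ r))
  ... | r , s , fr≤ = a ∷ r , Supp-∷ D a∈ s , ≤-trans fr≤ fa≤

  E-neg : ∀ {n} (D : Fin n → Dist) f → E D (λ r → - f r) ≡ - E D f
  E-neg D f = trans (E-cong D (λ r → neg-as-* (f r))) (trans (E-* D (- 1ℚ) f) (sym (neg-as-* (E D f))))
    where
    neg-as-* : ∀ x → - x ≡ - 1ℚ * x
    neg-as-* x = trans (cong -_ (sym (*-identityˡ x))) (neg-distribˡ-* 1ℚ x)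

  E-attains-≥ : ∀ {n} {D : Fin n → Dist} → (∀ v → IsProb (D v)) → ∀ f → ∃ λ r → Supp D r × E D f ≤ f r
  E-attains-≥ {D = D} pr f with E-attains-≤ pr (λ r → - f r)
  ... | r , s , le = r , s , subst₂ _≤_ (neg-involutive (E D f)) (neg-involutive (f r))
    (neg-antimono-≤ (subst (- f r ≤_) (E-neg D f) le))
    where
    neg-involutive : ∀ x → - - x ≡ x
    neg-involutive = solve-∀ ℚ-ring

-- Sets of vertices and the reward they carry

infixl 6 _─_

-- The library's difference of subsets does not reduce componentwise.
_─_ : ∀ {n} → Subset n → Subset n → Subset n
_─_ = zipWith (λ s t → if t then false else s)

sumS : ∀ {n} → Subset n → Vec ℕ n → ℕ
sumS []          []      = 0
sumS (true  ∷ S) (a ∷ r) = a ℕ.+ sumS S r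
sumS (false ∷ S) (_ ∷ r) = sumS S r

setOf : ∀ {n} → List (Fin n) → Subset n
setOf []      = ⊥
setOf (v ∷ p) = setOf p [ v ]≔ true

sumS-⊥ : ∀ {n} (r : Vec ℕ n) → sumS ⊥ r ≡ 0
sumS-⊥ []      = refl
sumS-⊥ (_ ∷ r) = sumS-⊥ r

sumS-insert : ∀ {n} (S : Subset n) v r → lookup S v ≡ false →
  sumS (S [ v ]≔ true) r ≡ sumS S r ℕ.+ lookup r v
sumS-insert (false ∷ S) zero    (a ∷ r) _ = ℕₚ.+-comm a (sumS S r)
sumS-insert (true  ∷ S) (suc v) (a ∷ r) h = trans (cong (a ℕ.+_) (sumS-insert S v r h)) (sym (ℕₚ.+-assoc a _ _))
sumS-insert (false ∷ S) (suc v) (a ∷ r) h = sumS-insert S v r h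

-- First-step accounting for a path that starts at `v` with reward `a`: `v` pays unless it lies in
-- `V`, and then joins `V`, so that the rest of the path does not count it again.
sumS-update : ∀ {n} (S V : Subset n) v r a →
  sumS ((S [ v ]≔ true) ─ V) (r [ v ]≔ a)
    ≡ (if lookup V v then 0 else a) ℕ.+ sumS (S ─ (V [ v ]≔ true)) r
sumS-update (s ∷ S) (true  ∷ V) zero (b ∷ r) a = refl
sumS-update (s ∷ S) (false ∷ V) zero (b ∷ r) a = refl
sumS-update (s ∷ S) (true  ∷ V) (suc v) (b ∷ r) a = sumS-update S V v r a
sumS-update (false ∷ S) (false ∷ V) (suc v) (b ∷ r) a = sumS-update S V v r a
sumS-update (true  ∷ S) (false ∷ V) (suc v) (b ∷ r) a = begin
  b ℕ.+ sumS ((S [ v ]≔ true) ─ V) (r [ v ]≔ a)  ≡⟨ cong (b ℕ.+_) (sumS-update S V v r a) ⟩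
  b ℕ.+ (w ℕ.+ t)                                ≡⟨ ℕₚ.+-assoc b w t ⟨
  b ℕ.+ w ℕ.+ t                                  ≡⟨ cong (ℕ._+ t) (ℕₚ.+-comm b w) ⟩
  w ℕ.+ b ℕ.+ t                                  ≡⟨ ℕₚ.+-assoc w b t ⟩
  w ℕ.+ (b ℕ.+ t)                                ∎
  where
  open ≡-Reasoning
  w = if lookup V v then 0 else a
  t = sumS (S ─ (V [ v ]≔ true)) r

sumS-avoid : ∀ {n} (U S : Subset n) v r a →
  sumS (U ─ (S [ v ]≔ true)) (r [ v ]≔ a) ≡ sumS (U ─ (S [ v ]≔ true)) r
sumS-avoid (u ∷ U) (s ∷ S) zero (b ∷ r) a = refl
sumS-avoid (u ∷ U) (true ∷ S) (suc v) (b ∷ r) a = sumS-avoid U S v r a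
sumS-avoid (true ∷ U) (false ∷ S) (suc v) (b ∷ r) a = cong (b ℕ.+_) (sumS-avoid U S v r a)
sumS-avoid (false ∷ U) (false ∷ S) (suc v) (b ∷ r) a = sumS-avoid U S v r a

─-insert : ∀ {n} (U S : Subset n) v → U ─ (S [ v ]≔ true) ≡ (U [ v ]≔ false) ─ S
─-insert (u ∷ U) (true  ∷ S) zero = refl
─-insert (u ∷ U) (false ∷ S) zero = refl
─-insert (u ∷ U) (true  ∷ S) (suc v) = cong (_ ∷_) (─-insert U S v)
─-insert (u ∷ U) (false ∷ S) (suc v) = cong (_ ∷_) (─-insert U S v)

─⊥ : ∀ {n} (S : Subset n) → S ─ ⊥ ≡ S
─⊥ []      = refl
─⊥ (s ∷ S) = cong (s ∷_) (─⊥ S)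

⊥─ : ∀ {n} (V : Subset n) → ⊥ ─ V ≡ ⊥
⊥─ []          = refl
⊥─ (true  ∷ V) = cong (_ ∷_) (⊥─ V)
⊥─ (false ∷ V) = cong (_ ∷_) (⊥─ V)

sumS-∪≥ʳ : ∀ {n} (S T : Subset n) r → sumS T r ℕ.≤ sumS (S ∪ T) r
sumS-∪≥ʳ []          []          []      = ℕ.z≤n
sumS-∪≥ʳ (true  ∷ S) (true  ∷ T) (a ∷ r) = ℕₚ.+-monoʳ-≤ a (sumS-∪≥ʳ S T r)
sumS-∪≥ʳ (true  ∷ S) (false ∷ T) (a ∷ r) = ℕₚ.m≤n⇒m≤o+n a (sumS-∪≥ʳ S T r)
sumS-∪≥ʳ (false ∷ S) (true  ∷ T) (a ∷ r) = ℕₚ.+-monoʳ-≤ a (sumS-∪≥ʳ S T r)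
sumS-∪≥ʳ (false ∷ S) (false ∷ T) (a ∷ r) = sumS-∪≥ʳ S T r

sumS-─ : ∀ {n} (S T : Subset n) r → sumS (S ─ T) r ℕ.≤ sumS S r
sumS-─ []          []          []      = ℕ.z≤n
sumS-─ (true  ∷ S) (true  ∷ T) (a ∷ r) = ℕₚ.m≤n⇒m≤o+n a (sumS-─ S T r)
sumS-─ (true  ∷ S) (false ∷ T) (a ∷ r) = ℕₚ.+-monoʳ-≤ a (sumS-─ S T r)
sumS-─ (false ∷ S) (true  ∷ T) (a ∷ r) = sumS-─ S T r
sumS-─ (false ∷ S) (false ∷ T) (a ∷ r) = sumS-─ S T r

-- Holds vertex by vertex: the left side counts `P ∪ U` once, and a vertex of `P` outside `U ∪ V` is
-- counted by `P ─ V`.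
sumS-exchange : ∀ {n} (P U V : Subset n) r →
  sumS P r ℕ.+ sumS (U ─ P) r ℕ.≤ sumS (U ∪ V) r ℕ.+ sumS (P ─ V) r
sumS-exchange [] [] [] [] = ℕ.z≤n
sumS-exchange (true ∷ P) (true ∷ U) (true ∷ V) (a ∷ r)
  rewrite ℕₚ.+-assoc a (sumS P r) (sumS (U ─ P) r) | ℕₚ.+-assoc a (sumS (U ∪ V) r) (sumS (P ─ V) r)
  = ℕₚ.+-monoʳ-≤ a (sumS-exchange P U V r)
sumS-exchange (true ∷ P) (true ∷ U) (false ∷ V) (a ∷ r)
  rewrite ℕₚ.+-assoc a (sumS P r) (sumS (U ─ P) r) | ℕₚ.+-assoc a (sumS (U ∪ V) r) (a ℕ.+ sumS (P ─ V) r)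
  = ℕₚ.+-monoʳ-≤ a (ℕₚ.≤-trans (sumS-exchange P U V r) (ℕₚ.+-monoʳ-≤ (sumS (U ∪ V) r) (ℕₚ.m≤n+m (sumS (P ─ V) r) a)))
sumS-exchange (true ∷ P) (false ∷ U) (true ∷ V) (a ∷ r)
  rewrite ℕₚ.+-assoc a (sumS P r) (sumS (U ─ P) r) | ℕₚ.+-assoc a (sumS (U ∪ V) r) (sumS (P ─ V) r)
  = ℕₚ.+-monoʳ-≤ a (sumS-exchange P U V r)
sumS-exchange (true ∷ P) (false ∷ U) (false ∷ V) (a ∷ r)
  rewrite ℕₚ.+-assoc a (sumS P r) (sumS (U ─ P) r)
        | sym (ℕₚ.+-assoc (sumS (U ∪ V) r) a (sumS (P ─ V) r))
        | ℕₚ.+-comm (sumS (U ∪ V) r) a | ℕₚ.+-assoc a (sumS (U ∪ V) r) (sumS (P ─ V) r)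
  = ℕₚ.+-monoʳ-≤ a (sumS-exchange P U V r)
sumS-exchange (false ∷ P) (true ∷ U) (v ∷ V) (a ∷ r)
  rewrite sym (ℕₚ.+-assoc (sumS P r) a (sumS (U ─ P) r)) | ℕₚ.+-comm (sumS P r) a
        | ℕₚ.+-assoc a (sumS P r) (sumS (U ─ P) r) = helper v
  where
  helper : ∀ v → a ℕ.+ (sumS P r ℕ.+ sumS (U ─ P) r) ℕ.≤
    a ℕ.+ sumS (U ∪ V) r ℕ.+ sumS ((false ∷ P) ─ (v ∷ V)) (a ∷ r)
  helper true  rewrite ℕₚ.+-assoc a (sumS (U ∪ V) r) (sumS (P ─ V) r) = ℕₚ.+-monoʳ-≤ a (sumS-exchange P U V r)
  helper false rewrite ℕₚ.+-assoc a (sumS (U ∪ V) r) (sumS (P ─ V) r) = ℕₚ.+-monoʳ-≤ a (sumS-exchange P U V r)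
sumS-exchange (false ∷ P) (false ∷ U) (true ∷ V) (a ∷ r)
  rewrite ℕₚ.+-assoc a (sumS (U ∪ V) r) (sumS (P ─ V) r) = ℕₚ.m≤n⇒m≤o+n a (sumS-exchange P U V r)
sumS-exchange (false ∷ P) (false ∷ U) (false ∷ V) (a ∷ r) = sumS-exchange P U V r

sumS-mix : ∀ {n} (S N : Subset n) r r′ →
  sumS (S ∪ N) (mix S r r′) ≡ sumS S r ℕ.+ sumS (N ─ S) r′
sumS-mix []          []          []      []       = refl
sumS-mix (true  ∷ S) (true  ∷ N) (a ∷ r) (b ∷ r′) = trans (cong (a ℕ.+_) (sumS-mix S N r r′)) (sym (ℕₚ.+-assoc a _ _))
sumS-mix (true  ∷ S) (false ∷ N) (a ∷ r) (b ∷ r′) = trans (cong (a ℕ.+_) (sumS-mix S N r r′)) (sym (ℕₚ.+-assoc a _ _))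
sumS-mix (false ∷ S) (false ∷ N) (a ∷ r) (b ∷ r′) = sumS-mix S N r r′
sumS-mix (false ∷ S) (true  ∷ N) (a ∷ r) (b ∷ r′) = begin
  b ℕ.+ sumS (S ∪ N) (mix S r r′)  ≡⟨ cong (b ℕ.+_) (sumS-mix S N r r′) ⟩
  b ℕ.+ (s ℕ.+ t)                  ≡⟨ ℕₚ.+-assoc b s t ⟨
  b ℕ.+ s ℕ.+ t                    ≡⟨ cong (ℕ._+ t) (ℕₚ.+-comm b s) ⟩
  s ℕ.+ b ℕ.+ t                    ≡⟨ ℕₚ.+-assoc s b t ⟩
  s ℕ.+ (b ℕ.+ t)                  ∎
  where
  open ≡-Reasoning
  s = sumS S r
  t = sumS (N ─ S) r′

-- The generating function of the reward carried by a set

F : ∀ {n} → ℚ → (Fin n → Dist) → Subset n → ℚ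
F x D []          = 1ℚ
F x D (true  ∷ S) = expect (D zero) (x ^_) * F x (D ∘ suc) S
F x D (false ∷ S) = F x (D ∘ suc) S

module _ {x : ℚ} where

  E-^sumS : ∀ {n} {D : Fin n → Dist} → (∀ v → IsProb (D v)) → ∀ S →
    E D (λ r → x ^ sumS S r) ≡ F x D S
  E-^sumS pr [] = refl
  E-^sumS {D = D} pr (true ∷ S) = begin
    expect (D zero) (λ a → E (D ∘ suc) (λ r → x ^ (a ℕ.+ sumS S r)))
      ≡⟨ expect-cong (D zero) (λ a → trans (E-cong (D ∘ suc) (λ r → ^-homo-* x a (sumS S r)))
           (trans (E-* (D ∘ suc) (x ^ a) _) (trans (cong (x ^ a *_) (E-^sumS (pr ∘ suc) S)) (*-comm (x ^ a) _)))) ⟩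
    expect (D zero) (λ a → F x (D ∘ suc) S * x ^ a)
      ≡⟨ expect-* (D zero) (F x (D ∘ suc) S) (x ^_) ⟩
    F x (D ∘ suc) S * expect (D zero) (x ^_)
      ≡⟨ *-comm _ (expect (D zero) (x ^_)) ⟩
    expect (D zero) (x ^_) * F x (D ∘ suc) S ∎
    where open ≡-Reasoning
  E-^sumS {D = D} pr (false ∷ S) =
    trans (expect-const (pr zero) _) (E-^sumS (pr ∘ suc) S)

  -- The two sets on the right are disjoint, so their rewards are independent. This peels paths off
  -- a union one at a time.
  F-split : ∀ {n} (D : Fin n → Dist) W U P → F x D ((W ∪ U) ─ P) ≡ F x D (W ─ P) * F x D (U ─ (P ∪ W))
  F-split D [] [] [] = refl
  F-split D (w ∷ W) (u ∷ U) (true ∷ P) = F-split (D ∘ suc) W U P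
  F-split D (true ∷ W) (u ∷ U) (false ∷ P) =
    trans (cong (expect (D zero) (x ^_) *_) (F-split (D ∘ suc) W U P)) (sym (*-assoc (expect (D zero) (x ^_)) _ _))
  F-split D (false ∷ W) (true ∷ U) (false ∷ P) =
    trans (cong (expect (D zero) (x ^_) *_) (F-split (D ∘ suc) W U P))
          (lemma (expect (D zero) (x ^_)) (F x (D ∘ suc) (W ─ P)) (F x (D ∘ suc) (U ─ (P ∪ W))))
    where
    lemma : ∀ a b c → a * (b * c) ≡ b * (a * c)
    lemma = solve-∀ ℚ-ring
  F-split D (false ∷ W) (false ∷ U) (false ∷ P) = F-split (D ∘ suc) W U P

  F-update : ∀ {n} {D : Fin n → Dist} → (∀ v → IsProb (D v)) → ∀ S V v →
    F x D ((S [ v ]≔ true) ─ V)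
      ≡ expect (D v) (λ a → x ^ (if lookup V v then 0 else a)) * F x D (S ─ (V [ v ]≔ true))
  F-update {D = D} pr (s ∷ S) (true  ∷ V) zero =
    sym (trans (cong (_* f) (expect-const (pr zero) 1ℚ)) (*-identityˡ f))
    where f = F x (D ∘ suc) (S ─ V)
  F-update pr (s ∷ S) (false ∷ V) zero = refl
  F-update pr (s ∷ S) (true  ∷ V) (suc v) = F-update (pr ∘ suc) S V v
  F-update pr (false ∷ S) (false ∷ V) (suc v) = F-update (pr ∘ suc) S V v
  F-update {D = D} pr (true ∷ S) (false ∷ V) (suc v) =
    trans (cong (expect (D zero) (x ^_) *_) (F-update (pr ∘ suc) S V v))
          (lemma (expect (D zero) (x ^_)) (expect (D (suc v)) (λ a → x ^ (if lookup V v then 0 else a)))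
                 (F x (D ∘ suc) (S ─ (V [ v ]≔ true))))
    where
    lemma : ∀ a b c → a * (b * c) ≡ b * (a * c)
    lemma = solve-∀ ℚ-ring

  F-nonneg : 0ℚ ≤ x → ∀ {n} {D : Fin n → Dist} → (∀ v → IsProb (D v)) → ∀ S → 0ℚ ≤ F x D S
  F-nonneg 0≤x pr S = subst₂ _≤_ (E-const pr 0ℚ) (E-^sumS pr S) (E-mono pr (λ r → ^-nonneg (sumS S r) 0≤x))

-- Decision trees run on a vector of rewards

run : ∀ {n} → Policy n → Vec ℕ n → List (Fin n)
run stop        r = []
run (visit v f) r = v ∷ run (f (lookup r v)) r

-- Required on all branches, also on those of probability zero.
NoRepeat : ∀ {n} → Subset n → Policy n → Set
NoRepeat S stop        = ⊤
NoRepeat S (visit v f) = lookup S v ≡ false × (∀ a → NoRepeat (S [ v ]≔ true) (f a))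

lookup-insert : ∀ {n} (S : Subset n) v → lookup (S [ v ]≔ true) v ≡ true
lookup-insert (_ ∷ S) zero    = refl
lookup-insert (_ ∷ S) (suc v) = lookup-insert S v

lookup-insert-mono : ∀ {n} (S : Subset n) v w → lookup S v ≡ true → lookup (S [ w ]≔ true) v ≡ true
lookup-insert-mono (_ ∷ S) zero    zero    _ = refl
lookup-insert-mono (_ ∷ S) zero    (suc w) h = h
lookup-insert-mono (_ ∷ S) (suc v) zero    h = h
lookup-insert-mono (_ ∷ S) (suc v) (suc w) h = lookup-insert-mono S v w h

lookup-≔-≢ : ∀ {n} {A : Set} (r : Vec A n) v w a → v ≢ w → lookup (r [ w ]≔ a) v ≡ lookup r v
lookup-≔-≢ (_ ∷ r) zero    zero    a h = ⊥-elim (h refl)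
lookup-≔-≢ (_ ∷ r) zero    (suc w) a h = refl
lookup-≔-≢ (_ ∷ r) (suc v) zero    a h = refl
lookup-≔-≢ (_ ∷ r) (suc v) (suc w) a h = lookup-≔-≢ r v w a (h ∘ cong suc)

lookup-≔ : ∀ {n} {A : Set} (r : Vec A n) v a → lookup (r [ v ]≔ a) v ≡ a
lookup-≔ (_ ∷ r) zero    a = refl
lookup-≔ (_ ∷ r) (suc v) a = lookup-≔ r v a

-- A visited vertex is never queried again, so its reward cannot influence the rest of the run.
run-update : ∀ {n} {S : Subset n} π r v a → NoRepeat S π → lookup S v ≡ true → run π (r [ v ]≔ a) ≡ run π r
run-update stop        r v a nr v∈S = refl
run-update {S = S} (visit w f) r v a (w∉S , nr) v∈S
  rewrite lookup-≔-≢ r w v a (λ { refl → case trans (sym w∉S) v∈S of λ () }) =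
    cong (w ∷_) (run-update (f (lookup r w)) r v a (nr _) (lookup-insert-mono S v w v∈S))

module _ {n} {D : Fin n → Dist} (pr : ∀ v → IsProb (D v)) where

  -- First-step analysis: the reward at `v` is redrawn separately, and the subtree that it selects
  -- ignores the old value.
  E-run : ∀ {S v f} → NoRepeat S (visit v f) → ∀ (G : List (Fin n) → Vec ℕ n → ℚ) →
    E D (λ r → G (run (visit v f) r) r) ≡ expect (D v) (λ a → E D (λ r → G (v ∷ run (f a) r) (r [ v ]≔ a)))
  E-run {S} {v} {f} (_ , nr) G =
    trans (E-resample pr v _) (expect-cong (D v) λ a → E-cong D λ r →
      cong (λ p → G (v ∷ p) (r [ v ]≔ a))
        (trans (cong (λ b → run (f b) (r [ v ]≔ a)) (lookup-≔ r v a))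
               (run-update (f a) r v a (nr a) (lookup-insert S v))))

  module _ {x} (0≤x : 0ℚ ≤ x) (x≤1 : x ≤ 1ℚ) where

    -- The tree chooses its way from visited rewards only, so given its path the rewards outside are
    -- still fresh. The induction removes each visited vertex from `U`.
    E-fresh : ∀ {S} π U → NoRepeat S π →
      E D (λ r → x ^ sumS (U ─ setOf (run π r)) r) ≡ E D (λ r → F x D (U ─ setOf (run π r)))
    E-fresh stop U nr = trans (E-^sumS pr (U ─ ⊥)) (sym (E-const pr _))
    E-fresh {S} (visit v f) U nr = begin
      E D (λ r → x ^ sumS (U ─ setOf (run (visit v f) r)) r)
        ≡⟨ E-run nr (λ p r → x ^ sumS (U ─ setOf p) r) ⟩
      expect (D v) (λ a → E D (λ r → x ^ sumS (U ─ (setOf (run (f a) r) [ v ]≔ true)) (r [ v ]≔ a)))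
        ≡⟨ expect-cong (D v) (λ a → E-cong D (λ r → cong (x ^_) (
             trans (sumS-avoid U (setOf (run (f a) r)) v r a)
                   (cong (λ T → sumS T r) (─-insert U (setOf (run (f a) r)) v))))) ⟩
      expect (D v) (λ a → E D (λ r → x ^ sumS ((U [ v ]≔ false) ─ setOf (run (f a) r)) r))
        ≡⟨ expect-cong (D v) (λ a → E-fresh (f a) (U [ v ]≔ false) (proj₂ nr a)) ⟩
      expect (D v) (λ a → E D (λ r → F x D ((U [ v ]≔ false) ─ setOf (run (f a) r))))
        ≡⟨ expect-cong (D v) (λ a → E-cong D (λ r → cong (F x D) (─-insert U (setOf (run (f a) r)) v))) ⟨
      expect (D v) (λ a → E D (λ r → F x D (U ─ (setOf (run (f a) r) [ v ]≔ true))))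
        ≡⟨ E-run nr (λ p r → F x D (U ─ setOf p)) ⟨
      E D (λ r → F x D (U ─ setOf (run (visit v f) r))) ∎
      where open ≡-Reasoning

    opaque
      unfolding 2ℚ

      -- The right-hand side is the same quantity for fresh rewards, independent of the path.
      decoupling : ∀ {S} π V → NoRepeat S π →
        1ℚ - E D (λ r → x ^ sumS (setOf (run π r) ─ V) r)
          ≤ 2ℚ * (1ℚ - E D (λ r → F x D (setOf (run π r) ─ V)))
      decoupling stop V nr = ≤-reflexive (trans (cong (_-_ 1ℚ) H≡1)
        (cong (λ z → 2ℚ * (1ℚ - z)) (sym K≡1)))
        where
        H≡1 : E D (λ r → x ^ sumS (⊥ ─ V) r) ≡ 1ℚ
        H≡1 = trans (E-cong D (λ r → cong (x ^_) (trans (cong (λ T → sumS T r) (⊥─ V)) (sumS-⊥ r)))) (E-const pr 1ℚ)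
        K≡1 : E D (λ r → F x D (⊥ ─ V)) ≡ 1ℚ
        K≡1 = trans (E-const pr _) (trans (sym (E-^sumS pr (⊥ ─ V))) H≡1)
      decoupling {S} (visit v f) V nr = conclude
        where
        V′ : Subset n
        V′ = V [ v ]≔ true
        g : ℕ → ℚ
        g a = x ^ (if lookup V v then 0 else a)
        φ : ℚ
        φ = expect (D v) g
        H K : ℕ → ℚ
        H a = E D (λ r → x ^ sumS (setOf (run (f a) r) ─ V′) r)
        K a = E D (λ r → F x D (setOf (run (f a) r) ─ V′))
        κ : ℚ
        κ = expect (D v) K

        H-eq : E D (λ r → x ^ sumS (setOf (run (visit v f) r) ─ V) r) ≡ expect (D v) (λ a → g a * H a)
        H-eq = trans (E-run nr (λ p r → x ^ sumS (setOf p ─ V) r)) (expect-cong (D v) λ a →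
          trans (E-cong D (λ r → trans (cong (x ^_) (sumS-update (setOf (run (f a) r)) V v r a))
                  (^-homo-* x (if lookup V v then 0 else a) _)))
                (E-* D (g a) _))
        K-eq : E D (λ r → F x D (setOf (run (visit v f) r) ─ V)) ≡ φ * κ
        K-eq = trans (E-run nr (λ p r → F x D (setOf p ─ V))) (trans (expect-cong (D v) λ a →
          trans (E-cong D (λ r → F-update pr (setOf (run (f a) r)) V v)) (E-* D φ _)) (expect-* (D v) φ K))

        0≤g : ∀ a → 0ℚ ≤ g a
        0≤g a = ^-nonneg (if lookup V v then 0 else a) 0≤x
        g≤1 : ∀ a → g a ≤ 1ℚ
        g≤1 a = ^-≤1 (if lookup V v then 0 else a) 0≤x x≤1
        0≤φ : 0ℚ ≤ φ
        0≤φ = subst (_≤ φ) (expect-const (pr v) 0ℚ) (expect-mono (D v) (IsProb.nonneg (pr v)) (λ {rp} _ → 0≤g (proj₁ rp)))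
        φ≤1 : φ ≤ 1ℚ
        φ≤1 = subst (φ ≤_) (expect-const (pr v) 1ℚ) (expect-mono (D v) (IsProb.nonneg (pr v)) (λ {rp} _ → g≤1 (proj₁ rp)))
        0≤H : ∀ a → 0ℚ ≤ H a
        0≤H a = subst (_≤ H a) (E-const pr 0ℚ) (E-mono pr (λ r → ^-nonneg (sumS (setOf (run (f a) r) ─ V′) r) 0≤x))
        H≤1 : ∀ a → H a ≤ 1ℚ
        H≤1 a = subst (H a ≤_) (E-const pr 1ℚ) (E-mono pr (λ r → ^-≤1 (sumS (setOf (run (f a) r) ─ V′) r) 0≤x x≤1))

        -- `g a` and `H a` both depend on `a`, so their product is bounded below by linear terms:
        -- `gH ≥ g + H - 1`, then `H ≥ φH`, and `H ≥ 2K - 1` by induction. Averaging turns `g` into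
        -- `φ`.
        pointwise : ∀ a → g a + ((- (1ℚ + φ)) + (φ + φ) * K a) ≤ g a * H a
        pointwise a = ≤-by (diff≥0 (g≤1 a) ⊛ diff≥0 (H≤1 a) ⊕ diff≥0 φ≤1 ⊛ 0≤H a
                             ⊕ 0≤φ ⊛ diff≥0 (decoupling (f a) V′ (proj₂ nr a)))
                           (lemma (g a) φ (H a) (K a))
          where
          lemma : ∀ g φ H K → g * H ≡ (g + ((- (1ℚ + φ)) + (φ + φ) * K))
            + ((1ℚ - g) * (1ℚ - H) + (1ℚ - φ) * H + φ * (2ℚ * (1ℚ - K) - (1ℚ - H)))
          lemma = solve-∀ ℚ-ring

        averaged : φ + ((- (1ℚ + φ)) + (φ + φ) * κ) ≤ expect (D v) (λ a → g a * H a)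
        averaged = subst (_≤ expect (D v) (λ a → g a * H a))
          (trans (expect-+ (D v) g _) (cong (φ +_) (trans (expect-+ (D v) _ _)
            (cong₂ _+_ (expect-const (pr v) (- (1ℚ + φ))) (expect-* (D v) (φ + φ) K)))))
          (expect-mono (D v) (IsProb.nonneg (pr v)) (λ {rp} _ → pointwise (proj₁ rp)))

        conclude : 1ℚ - E D (λ r → x ^ sumS (setOf (run (visit v f) r) ─ V) r)
          ≤ 2ℚ * (1ℚ - E D (λ r → F x D (setOf (run (visit v f) r) ─ V)))
        conclude = subst₂ (λ h k → 1ℚ - h ≤ 2ℚ * (1ℚ - k)) (sym H-eq) (sym K-eq)
          (≤-by (diff≥0 averaged) (lemma φ κ (expect (D v) (λ a → g a * H a))))
          where
          lemma : ∀ φ κ h → 2ℚ * (1ℚ - φ * κ) ≡ (1ℚ - h) + (h - (φ + ((- (1ℚ + φ)) + (φ + φ) * κ)))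
          lemma = solve-∀ ℚ-ring

-- Scales

ι : ℕ → ℚ
ι zero    = 0ℚ
ι (suc n) = 1ℚ + ι n

ι-nonneg : ∀ n → 0ℚ ≤ ι n
ι-nonneg zero    = ≤-refl
ι-nonneg (suc n) = 0≤1 ⊕ ι-nonneg n

ι-pos : ∀ n → Positive (ι (suc n))
ι-pos n = pos+nonNeg⇒pos 1ℚ (ι n) {{nonNegative (ι-nonneg n)}}

bernoulli⁻ : ∀ {y} n → 0ℚ ≤ y → y ≤ 1ℚ → 1ℚ - ι n * y ≤ (1ℚ - y) ^ n
bernoulli⁻ {y} zero    0≤y y≤1 = ≤-reflexive (lemma y)
  where
  lemma : ∀ y → 1ℚ - 0ℚ * y ≡ 1ℚ
  lemma = solve-∀ ℚ-ring
bernoulli⁻ {y} (suc n) 0≤y y≤1 =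
  ≤-by (diff≥0 y≤1 ⊛ diff≥0 (bernoulli⁻ n 0≤y y≤1) ⊕ ι-nonneg n ⊛ (0≤y ⊛ 0≤y))
       (lemma y (ι n) ((1ℚ - y) ^ n))
  where
  lemma : ∀ y i z → (1ℚ - y) * z ≡ (1ℚ - (1ℚ + i) * y) + ((1ℚ - y) * (z - (1ℚ - i * y)) + i * (y * y))
  lemma = solve-∀ ℚ-ring

bernoulli⁺ : ∀ {y} n → 0ℚ ≤ y → 1ℚ + ι n * y ≤ (1ℚ + y) ^ n
bernoulli⁺ {y} zero    0≤y = ≤-reflexive (lemma y)
  where
  lemma : ∀ y → 1ℚ + 0ℚ * y ≡ 1ℚ
  lemma = solve-∀ ℚ-ring
bernoulli⁺ {y} (suc n) 0≤y =
  ≤-by ((0≤1 ⊕ 0≤y) ⊛ diff≥0 (bernoulli⁺ n 0≤y) ⊕ ι-nonneg n ⊛ (0≤y ⊛ 0≤y))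
       (lemma y (ι n) ((1ℚ + y) ^ n))
  where
  lemma : ∀ y i z → (1ℚ + y) * z ≡ (1ℚ + (1ℚ + i) * y) + ((1ℚ + y) * (z - (1ℚ + i * y)) + i * (y * y))
  lemma = solve-∀ ℚ-ring

[1-y²]^n≤1 : ∀ {y} n → 0ℚ ≤ y → y ≤ 1ℚ → (1ℚ - y) ^ n * (1ℚ + y) ^ n ≤ 1ℚ
[1-y²]^n≤1     zero    0≤y y≤1 = ≤-refl
[1-y²]^n≤1 {y} (suc n) 0≤y y≤1 =
  ≤-by (diff≥0 ([1-y²]^n≤1 n 0≤y y≤1) ⊕ (0≤y ⊛ 0≤y) ⊛ (^-nonneg n (diff≥0 y≤1) ⊛ ^-nonneg n (0≤1 ⊕ 0≤y)))
       (lemma y ((1ℚ - y) ^ n) ((1ℚ + y) ^ n))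
  where
  lemma : ∀ y u v → 1ℚ ≡ ((1ℚ - y) * u) * ((1ℚ + y) * v) + ((1ℚ - u * v) + (y * y) * (u * v))
  lemma = solve-∀ ℚ-ring

opaque
  unfolding 2ℚ

  -- Let `y` be the gap, so `(m + 1) y = ½`. Bernoulli gives `(1 - y)^(m+1) ≥ ½` and
  -- `(1 + y)^(m+1) ≥ 3/2`; the product of these powers is at most 1, whence `(1 - y)^(m+1) ≤ ⅔`.
  gap : ℕ → ℚ
  gap m = ½ * (1/ ι (suc m)) {{pos⇒nonZero (ι (suc m)) {{ι-pos m}}}}

  scale : ℕ → ℚ
  scale m = 1ℚ - gap m

  ι*gap : ∀ m → ι (suc m) * gap m ≡ ½
  ι*gap m = trans (lemma (ι (suc m)) ½ i) (trans (cong (½ *_) (*-inverseʳ (ι (suc m)) {{nz}})) (*-identityʳ ½))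
    where
    nz : NonZero (ι (suc m))
    nz = pos⇒nonZero (ι (suc m)) {{ι-pos m}}
    i : ℚ
    i = (1/ ι (suc m)) {{nz}}
    lemma : ∀ a b c → a * (b * c) ≡ b * (a * c)
    lemma = solve-∀ ℚ-ring

  gap-nonneg : ∀ m → 0ℚ ≤ gap m
  gap-nonneg m = *-cancelˡ-≤-pos (ι (suc m)) {{ι-pos m}}
    (subst₂ _≤_ (sym (*-zeroʳ (ι (suc m)))) (sym (ι*gap m)) (nonNegative⁻¹ ½))

  gap≤½ : ∀ m → gap m ≤ ½
  gap≤½ m = subst (gap m ≤_) (ι*gap m) (≤-by (ι-nonneg m ⊛ gap-nonneg m) (lemma (ι m) (gap m)))
    where
    lemma : ∀ i y → (1ℚ + i) * y ≡ y + i * y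
    lemma = solve-∀ ℚ-ring

  gap≤1 : ∀ m → gap m ≤ 1ℚ
  gap≤1 m = ≤-trans (gap≤½ m) (from-yes (½ ≤? 1ℚ))

  scale-nonneg : ∀ m → 0ℚ ≤ scale m
  scale-nonneg m = diff≥0 (gap≤1 m)

  scale≤1 : ∀ m → scale m ≤ 1ℚ
  scale≤1 m = ≤-by (gap-nonneg m) (lemma (gap m))
    where
    lemma : ∀ y → 1ℚ ≡ (1ℚ - y) + y
    lemma = solve-∀ ℚ-ring

  1≤2scale^ : ∀ m → 1ℚ ≤ 2ℚ * scale m ^ suc m
  1≤2scale^ m = *-monoˡ-≤ 0≤2
    (subst (λ z → 1ℚ - z ≤ scale m ^ suc m) (ι*gap m) (bernoulli⁻ (suc m) (gap-nonneg m) (gap≤1 m)))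

  scale^≤⅔ : ∀ m → 1ℚ ≤ 3ℚ * (1ℚ - scale m ^ suc m)
  scale^≤⅔ m = ≤-by
    ((0≤1 ⊕ 0≤1) ⊛ (diff≥0 ([1-y²]^n≤1 (suc m) (gap-nonneg m) (gap≤1 m)) ⊕
      ^-nonneg (suc m) (scale-nonneg m) ⊛ diff≥0 (subst (λ z → 1ℚ + z ≤ (1ℚ + gap m) ^ suc m) (ι*gap m)
        (bernoulli⁺ (suc m) (gap-nonneg m)))))
    (lemma (scale m ^ suc m) ((1ℚ + gap m) ^ suc m))
    where
    lemma : ∀ u v → (1ℚ + 1ℚ + 1ℚ) * (1ℚ - u) ≡ 1ℚ + (1ℚ + 1ℚ) * ((1ℚ - u * v) + u * (v - (1ℚ + ½)))
    lemma = solve-∀ ℚ-ring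

-- One round

setOf-++ : ∀ {n} (p q : List (Fin n)) → setOf (p ++ q) ≡ setOf p ∪ setOf q
setOf-++ []      q = sym (∪-identityˡ (setOf q))
setOf-++ (v ∷ p) q = trans (cong (_[ v ]≔ true) (setOf-++ p q)) (insert-∪ (setOf p) (setOf q) v)
  where
  insert-∪ : ∀ {n} (S T : Subset n) v → (S ∪ T) [ v ]≔ true ≡ (S [ v ]≔ true) ∪ T
  insert-∪ (s ∷ S) (t ∷ T) zero    = refl
  insert-∪ (s ∷ S) (t ∷ T) (suc v) = cong (_ ∷_) (insert-∪ S T v)

F-⊥ : ∀ x {n} (D : Fin n → Dist) → F x D ⊥ ≡ 1ℚ
F-⊥ x {zero}  D = refl
F-⊥ x {suc n} D = F-⊥ x (D ∘ suc)

-- Opaque, since normalising a goal that contains concrete fractions is slow.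
opaque
  unfolding 2ℚ

  θ ¼ ¾ : ℚ
  -- `1 - θ = 1/24` absorbs the factor 2 of decoupling and the factor 3 of Markov's inequality and
  -- still leaves `¼`.
  θ = ℤ.+ 23 / 24
  ¼ = ℤ.+ 1 / 4
  ¾ = ℤ.+ 3 / 4

  rounds : ℕ
  -- The least exponent with `2 θ ^ rounds ≤ ¼`.
  rounds = 49

  0≤θ : 0ℚ ≤ θ
  0≤θ = from-yes (0ℚ ≤? θ)

  0≤¼ : 0ℚ ≤ ¼
  0≤¼ = from-yes (0ℚ ≤? ¼)

  ¼≤¾ : ¼ ≤ ¾
  ¼≤¾ = from-yes (¼ ≤? ¾)

  ¼+¼+¼≤¾ : ¼ + ¼ + ¼ ≤ ¾
  ¼+¼+¼≤¾ = from-yes (¼ + ¼ + ¼ ≤? ¾)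

  2θ^rounds≤¼ : 2ℚ * θ ^ rounds ≤ ¼
  2θ^rounds≤¼ = from-yes (2ℚ * θ ^ 49 ≤? ¼)

  6[1-θ]≤¼ : 3ℚ * (2ℚ * (1ℚ - θ)) ≤ ¼
  6[1-θ]≤¼ = from-yes (3ℚ * (2ℚ * (1ℚ - θ)) ≤? ¼)

module Round {n} {D : Fin n → Dist} (pr : ∀ v → IsProb (D v)) {S₀} {π : Policy n} (nr : NoRepeat S₀ π) where

  P : Vec ℕ n → Subset n
  P r = setOf (run π r)

  IsRun : List (Fin n) → Set
  IsRun p = ∃ λ r → p ≡ run π r

  module _ (x : ℚ) where

    -- A value near 1 means that a path of `π`, given fresh rewards, carries little outside `q` at
    -- the scale of `x`.
    f : List (Fin n) → ℚ
    f q = E D (λ r → F x D (P r ─ setOf q))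

    -- By `F-split`, the mean generating function of the reward that `s` independent paths, given
    -- fresh rewards, carry outside `q`.
    Φ : ℕ → List (Fin n) → ℚ
    Φ zero    q = 1ℚ
    Φ (suc s) q = E D (λ r → F x D (P r ─ setOf q) * Φ s (q ++ run π r))

    opaque
      -- While `f` stays below `θ`, each further path gains a factor `θ`; once it does not, the
      -- paths chosen so far are the witness.
      Φ-decay : 0ℚ ≤ x → ∀ s q → Φ s q ≤ θ ^ s ⊎
        ∃ λ ps → length ps ℕ.≤ s × All IsRun ps × θ ≤ f (q ++ concat ps)
      Φ-decay 0≤x zero    q = inj₁ ≤-refl
      Φ-decay 0≤x (suc s) q with θ ≤? f q
      ... | yes θ≤f = inj₂ ([] , ℕ.z≤n , [] , subst (λ q → θ ≤ f q) (sym (Listₚ.++-identityʳ q)) θ≤f)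
      ... | no  θ≰f with attained
        where
        -- A single run decides the alternative: where `excess` is at least its mean, `Ψ r ≤ θ ^ s`
        -- makes it nonpositive, hence `Φ (suc s) q ≤ θ ^ s * f q`.
        w Ψ excess : Vec ℕ n → ℚ
        w r = F x D (P r ─ setOf q)
        Ψ r = Φ s (q ++ run π r)
        excess r = w r * Ψ r + (- (θ ^ s)) * w r
        E-excess : E D excess ≡ Φ (suc s) q + (- (θ ^ s)) * f q
        E-excess = trans (E-+ D (λ r → w r * Ψ r) (λ r → (- (θ ^ s)) * w r))
                         (cong (Φ (suc s) q +_) (E-* D (- (θ ^ s)) w))
        attained : ∃ λ r → Φ (suc s) q + (- (θ ^ s)) * f q ≤ excess r
        attained with E-attains-≥ pr excess
        ... | r , _ , le = r , subst (_≤ excess r) E-excess le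
      ...   | r , le with Φ-decay 0≤x s (q ++ run π r)
      ...     | inj₂ (ps , len , runs , found) =
        inj₂ (run π r ∷ ps , ℕ.s≤s len , (r , refl) ∷ runs ,
              subst (λ q → θ ≤ f q) (Listₚ.++-assoc q (run π r) (concat ps)) found)
      ...     | inj₁ Φ≤ = inj₁ (≤-by
        (diff≥0 le ⊕ F-nonneg 0≤x pr (P r ─ setOf q) ⊛ diff≥0 Φ≤
          ⊕ ^-nonneg s 0≤θ ⊛ diff≥0 (<⇒≤ (≰⇒> θ≰f)))
        (lemma θ (θ ^ s) (Φ (suc s) q) (f q) (F x D (P r ─ setOf q)) (Φ s (q ++ run π r))))
        where
        lemma : ∀ t u a b c d → t * u ≡ a + (((c * d + (- u) * c) - (a + (- u) * b)) + c * (u - d) + u * (t - b))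
        lemma = solve-∀ ℚ-ring

      -- Fixes the random paths inside `Φ` one at a time by averaging. The weight `c` carries the
      -- factors of the paths already fixed; `q` depends on `r` because it starts as the path of `π`
      -- itself.
      Φ-attained : ∀ s (c : Vec ℕ n → ℚ) (q : Vec ℕ n → List (Fin n)) →
        ∃ λ ps → length ps ℕ.≤ s × All IsRun ps ×
          E D (λ r → c r * F x D (setOf (concat ps) ─ setOf (q r))) ≤ E D (λ r → c r * Φ s (q r))
      Φ-attained zero c q = [] , ℕ.z≤n , [] ,
        ≤-reflexive (E-cong D (λ r → cong (c r *_) (trans (cong (F x D) (⊥─ (setOf (q r)))) (F-⊥ x D))))
      Φ-attained (suc s) c q
        with E-attains-≤ pr (λ r₁ → E D (λ r → c r * F x D (P r₁ ─ setOf (q r)) * Φ s (q r ++ run π r₁)))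
      ... | r₁ , _ , le
        with Φ-attained s (λ r → c r * F x D (P r₁ ─ setOf (q r))) (λ r → q r ++ run π r₁)
      ... | ps , len , runs , le′ = run π r₁ ∷ ps , ℕ.s≤s len , (r₁ , refl) ∷ runs ,
        subst₂ _≤_ (E-cong D unfold) fubini (≤-trans le′ le)
        where
        U : Subset n
        U = setOf (concat ps)
        unfold : ∀ r → c r * F x D (P r₁ ─ setOf (q r)) * F x D (U ─ setOf (q r ++ run π r₁))
          ≡ c r * F x D (setOf (concat (run π r₁ ∷ ps)) ─ setOf (q r))
        unfold r = trans (*-assoc (c r) _ _) (cong (c r *_) (trans
          (cong (λ T → F x D (P r₁ ─ setOf (q r)) * F x D (U ─ T)) (setOf-++ (q r) (run π r₁)))
          (trans (sym (F-split D (P r₁) U (setOf (q r))))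
                 (cong (λ T → F x D (T ─ setOf (q r))) (sym (setOf-++ (run π r₁) (concat ps)))))))
        fubini : E D (λ r₁ → E D (λ r → c r * F x D (P r₁ ─ setOf (q r)) * Φ s (q r ++ run π r₁)))
          ≡ E D (λ r → c r * Φ (suc s) (q r))
        fubini = trans (E-swap D D _) (E-cong D (λ r →
          trans (E-cong D (λ r₁ → *-assoc (c r) _ _)) (E-* D (c r) _)))

  Gain : ℕ → Set
  Gain j = ∃ λ ps → length ps ℕ.≤ rounds × All IsRun ps ×
    E D (λ r → ⟦ sumS (setOf (concat ps) ─ P r) r ℕ.<? j ⟧) ≤ ¼

  -- Complementary to `Gain` at the same `j`: there the paths bring at least `j` beyond `P`, here
  -- `P` brings at most `j` beyond the paths. The extra path is the run from which `Φ-decay` starts.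
  Found : ℕ → Set
  Found j = ∃ λ ps → length ps ℕ.≤ suc rounds × All IsRun ps ×
    E D (λ r → ⟦ j ℕ.<? sumS (P r ─ setOf (concat ps)) r ⟧) ≤ ¼

  opaque
    -- After the paths are fixed, `E-fresh` returns from fresh to actual rewards. Markov's
    -- inequality then applies, as reward at most `m` forces `x ^ reward ≥ ½`.
    gain : ∀ m → E D (λ r → Φ (scale m) rounds (run π r)) ≤ θ ^ rounds → Gain (suc m)
    gain m small with Φ-attained (scale m) rounds (λ _ → 1ℚ) (run π)
    ... | ps , len , runs , le = ps , len , runs ,
      ≤-trans (E-mono-* (λ r → x ^ sumS (U ─ P r) r) pr 0≤2 pointwise fresh) 2θ^rounds≤¼
      where
      x : ℚ
      x = scale m
      U : Subset n
      U = setOf (concat ps)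
      pointwise : ∀ r → ⟦ sumS (U ─ P r) r ℕ.<? suc m ⟧ ≤ 2ℚ * x ^ sumS (U ─ P r) r
      pointwise r = ⟦⟧-bound (sumS (U ─ P r) r ℕ.<? suc m) (0≤2 ⊛ ^-nonneg (sumS (U ─ P r) r) (scale-nonneg m))
        (λ lt → ≤-trans (1≤2scale^ m) (*-monoˡ-≤ 0≤2 (^-anti (scale-nonneg m) (scale≤1 m) (ℕₚ.<⇒≤ lt))))
      1* : ∀ (g : Vec ℕ n → ℚ) → E D (λ r → 1ℚ * g r) ≡ E D g
      1* g = E-cong D (λ r → *-identityˡ (g r))
      fresh : E D (λ r → x ^ sumS (U ─ P r) r) ≤ θ ^ rounds
      fresh = subst (_≤ θ ^ rounds)
        (trans (1* (λ r → F x D (U ─ P r))) (sym (E-fresh pr (scale-nonneg m) (scale≤1 m) π U nr)))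
        (≤-trans le (subst (_≤ θ ^ rounds) (sym (1* (λ r → Φ x rounds (run π r)))) small))

    -- The rewards on `P ─ V` steer the tree itself, so freshness fails and `decoupling` pays a
    -- factor 2. Markov's inequality applies since reward above `m` forces `x ^ reward ≤ ⅔`.
    found : ∀ m ps → length ps ℕ.≤ suc rounds → All IsRun ps →
      θ ≤ f (scale m) (concat ps) → Found m
    found m ps len runs θ≤f = ps , len , runs ,
      ≤-trans (E-mono-* (λ r → 1ℚ - x ^ sumS (P r ─ V) r) pr 0≤3 pointwise
        (subst (_≤ 2ℚ * (1ℚ - f x (concat ps))) 1-E (decoupling pr (scale-nonneg m) (scale≤1 m) π V nr)))
      (≤-trans (*-monoˡ-≤ 0≤3 (*-monoˡ-≤ 0≤2 (+-monoʳ-≤ 1ℚ (neg-antimono-≤ θ≤f)))) 6[1-θ]≤¼)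
      where
      x : ℚ
      x = scale m
      V : Subset n
      V = setOf (concat ps)
      pointwise : ∀ r → ⟦ m ℕ.<? sumS (P r ─ V) r ⟧ ≤ 3ℚ * (1ℚ - x ^ sumS (P r ─ V) r)
      pointwise r = ⟦⟧-bound (m ℕ.<? sumS (P r ─ V) r)
        (0≤3 ⊛ diff≥0 (^-≤1 (sumS (P r ─ V) r) (scale-nonneg m) (scale≤1 m)))
        (λ lt → ≤-trans (scale^≤⅔ m) (*-monoˡ-≤ 0≤3
          (+-monoʳ-≤ 1ℚ (neg-antimono-≤ (^-anti (scale-nonneg m) (scale≤1 m) lt)))))
      1-E : 1ℚ - E D (λ r → x ^ sumS (P r ─ V) r) ≡ E D (λ r → 1ℚ - x ^ sumS (P r ─ V) r)
      1-E = sym (trans (E-+ D (λ _ → 1ℚ) (λ r → - x ^ sumS (P r ─ V) r))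
        (cong₂ _+_ (E-const pr 1ℚ) (E-neg D (λ r → x ^ sumS (P r ─ V) r))))

    -- `Φ-decay` is applied at a run where `Φ` is at least its mean: if `Φ` is small there, it is
    -- small on average.
    gain-or-found : ∀ m → Gain (suc m) ⊎ Found m
    gain-or-found m with E-attains-≥ pr (λ r → Φ (scale m) rounds (run π r))
    ... | r , _ , le with Φ-decay (scale m) (scale-nonneg m) rounds (run π r)
    ...   | inj₁ Φ≤ = inj₁ (gain m (≤-trans le Φ≤))
    ...   | inj₂ (ps , len , runs , θ≤f) = inj₂ (found m (run π r ∷ ps) (ℕ.s≤s len) ((r , refl) ∷ runs) θ≤f)

  Covers : ℕ → Set
  Covers k = ∃ λ ps → length ps ℕ.≤ rounds ℕ.+ suc rounds × All IsRun ps ×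
    E D (λ r → ⟦ sumS (setOf (concat ps)) r ℕ.<? k ⟧) ≤ ¾

  module _ (k : ℕ) (likely : E D (λ r → ⟦ sumS (P r) r ℕ.<? k ⟧) ≤ ¼) where

    opaque
      -- Outside three bad events of probability at most `¼` each, the exchange inequality reads
      -- `k + j ≤ r(U ∪ V) + j`.
      combine : ∀ {j} → Gain j → Found j → Covers k
      combine {j} (us , lenᵘ , runsᵘ , gainᵘ) (vs , lenᵛ , runsᵛ , foundᵛ) =
        us ++ vs , subst (ℕ._≤ rounds ℕ.+ suc rounds) (sym (Listₚ.length-++ us)) (ℕₚ.+-mono-≤ lenᵘ lenᵛ) ,
        Allₚ.++⁺ runsᵘ runsᵛ ,
        ≤-trans (E-mono pr pointwise) (≤-trans (≤-reflexive (E-+₃ D (λ r → ⟦ A? r ⟧) (λ r → ⟦ B? r ⟧) (λ r → ⟦ C? r ⟧)))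
          (≤-trans (+-mono-≤ (+-mono-≤ likely foundᵛ) gainᵘ) ¼+¼+¼≤¾))
        where
        U V : Subset n
        U = setOf (concat us)
        V = setOf (concat vs)
        cover : setOf (concat (us ++ vs)) ≡ U ∪ V
        cover = trans (cong setOf (sym (Listₚ.concat-++ us vs))) (setOf-++ (concat us) (concat vs))
        A? : ∀ r → Dec (sumS (P r) r ℕ.< k)
        A? r = sumS (P r) r ℕ.<? k
        B? : ∀ r → Dec (j ℕ.< sumS (P r ─ V) r)
        B? r = j ℕ.<? sumS (P r ─ V) r
        C? : ∀ r → Dec (sumS (U ─ P r) r ℕ.< j)
        C? r = sumS (U ─ P r) r ℕ.<? j
        pointwise : ∀ r → ⟦ sumS (setOf (concat (us ++ vs))) r ℕ.<? k ⟧ ≤ ⟦ A? r ⟧ + ⟦ B? r ⟧ + ⟦ C? r ⟧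
        pointwise r = ⟦⟧-union (sumS (setOf (concat (us ++ vs))) r ℕ.<? k) (A? r) (B? r) (C? r) λ P≮k j≮V U≮j →
          ℕₚ.≤⇒≯ (ℕₚ.+-cancelʳ-≤ j k (sumS (setOf (concat (us ++ vs))) r)
            (ℕₚ.≤-trans (ℕₚ.+-mono-≤ (ℕₚ.≮⇒≥ P≮k) (ℕₚ.≮⇒≥ U≮j))
            (ℕₚ.≤-trans (sumS-exchange (P r) U V r)
            (ℕₚ.≤-trans (ℕₚ.+-monoʳ-≤ (sumS (U ∪ V) r) (ℕₚ.≮⇒≥ j≮V))
                        (ℕₚ.≤-reflexive (cong (λ T → sumS T r ℕ.+ j) (sym cover)))))))

    -- Climbs the scales, with `d` the distance left to `k`. The first `Found` meets the `Gain` just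
    -- established at the same scale; if none occurs, `Gain k` covers by itself.
    search : ∀ d j → d ℕ.+ j ≡ k → Gain j → Covers k
    search zero j refl (us , len , runs , le) =
      us , ℕₚ.≤-trans len (ℕₚ.m≤m+n rounds (suc rounds)) , runs ,
      ≤-trans (E-mono pr λ r → ⟦⟧-mono (sumS (setOf (concat us)) r ℕ.<? j) (sumS (setOf (concat us) ─ P r) r ℕ.<? j)
                (ℕₚ.≤-<-trans (sumS-─ (setOf (concat us)) (P r) r)))
              (≤-trans le ¼≤¾)
    search (suc d) j eq g with gain-or-found j
    ... | inj₁ g′ = search d (suc j) (trans (ℕₚ.+-suc d j) eq) g′
    ... | inj₂ h  = combine g h

    covers : Covers k
    covers = search k 0 (ℕₚ.+-identityʳ k) ([] , ℕ.z≤n , [] ,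
      ≤-trans (≤-reflexive (trans (E-cong D (λ r → ⟦⟧-false (sumS (setOf (concat []) ─ P r) r ℕ.<? 0) λ ())) (E-const pr 0ℚ)))
              0≤¼)

-- Progress of one round, conditional on the rewards already seen.

first-failure : ∀ {Z : ℕ → Set} → Decidable Z → Z 0 → ∀ k → ¬ Z k → ∃ λ t → Z t × ¬ Z (suc t)
first-failure Z? z₀ zero    ¬zk = ⊥-elim (¬zk z₀)
first-failure Z? z₀ (suc k) ¬zk with Z? k
... | yes zk = k , zk , ¬zk
... | no ¬zk′ = first-failure Z? z₀ k ¬zk′

opaque
  unfolding 2ℚ θ

  4ℚ : ℚ
  4ℚ = 2ℚ + 2ℚ

  0≤4 : 0ℚ ≤ 4ℚ
  0≤4 = 0≤2 ⊕ 0≤2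

  ¾≡1-¼ : ¾ ≡ 1ℚ - ¼
  ¾≡1-¼ = refl

  4¼≡1 : 4ℚ * ¼ ≡ 1ℚ
  4¼≡1 = refl

¼-split : ∀ u → u ≡ ¾ * u + ¼ * u
¼-split u = trans (lemma ¼ u) (cong (λ z → z * u + ¼ * u) (sym ¾≡1-¼))
  where
  lemma : ∀ c u → u ≡ (1ℚ - c) * u + c * u
  lemma = solve-∀ ℚ-ring

¼≤1 : ¼ ≤ 1ℚ
¼≤1 = ≤-by (≤-trans 0≤¼ ¼≤¾) (trans (lemma ¼) (cong (¼ +_) (sym ¾≡1-¼)))
  where
  lemma : ∀ a → 1ℚ ≡ a + (1ℚ - a)
  lemma = solve-∀ ℚ-ring

-- Outcomes that had reached `k` stay resolved, good ones drop to `¾`, and no gain is claimed for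
-- the rest. Early outcomes are charged in full, since their probability will be zero.
charge : ∀ {A G L : Set} (A? : Dec A) (G? : Dec G) (L? : Dec L) {x} → x ≤ 1ℚ →
  (¬ A → x ≤ 0ℚ) → (G → A) → (G → ¬ L → x ≤ ¾) → x ≤ ⟦ A? ⟧ + (- ¼) * ⟦ G? ⟧ + ⟦ L? ⟧
charge (no ¬a) (yes g) L?      x≤1 h₀ G⇒A h = ⊥-elim (¬a (G⇒A g))
charge (no ¬a) (no _)  L?  {x} x≤1 h₀ G⇒A h = ≤-by (diff≥0 (h₀ ¬a) ⊕ ⟦⟧-nonneg L?) (lemma ¼ x ⟦ L? ⟧)
  where
  lemma : ∀ c x l → 0ℚ + (- c) * 0ℚ + l ≡ x + ((0ℚ - x) + l)
  lemma = solve-∀ ℚ-ring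
charge (yes _) (no _)  L?  {x} x≤1 h₀ G⇒A h = ≤-by (diff≥0 x≤1 ⊕ ⟦⟧-nonneg L?) (lemma ¼ x ⟦ L? ⟧)
  where
  lemma : ∀ c x l → 1ℚ + (- c) * 0ℚ + l ≡ x + ((1ℚ - x) + l)
  lemma = solve-∀ ℚ-ring
charge (yes _) (yes _) (yes _) {x} x≤1 h₀ G⇒A h = ≤-by (diff≥0 x≤1 ⊕ diff≥0 ¼≤1) (lemma ¼ x)
  where
  lemma : ∀ c x → 1ℚ + (- c) * 1ℚ + 1ℚ ≡ x + ((1ℚ - x) + (1ℚ - c))
  lemma = solve-∀ ℚ-ring
charge (yes _) (yes g) (no ¬l) {x} x≤1 h₀ G⇒A h =
  ≤-by (diff≥0 (h g ¬l)) (trans (lemma ¼ x) (cong (λ z → x + (z - x)) (sym ¾≡1-¼)))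
  where
  lemma : ∀ c x → 1ℚ + (- c) * 1ℚ + 0ℚ ≡ x + ((1ℚ - c) - x)
  lemma = solve-∀ ℚ-ring

module Progress {n} {D : Fin n → Dist} (pr : ∀ v → IsProb (D v)) (k : ℕ) where

  short : Subset n → Vec ℕ n → ℚ
  short S r = ⟦ sumS S r ℕ.<? k ⟧

  u : Subset n → ℚ
  u S = E D (short S)

  u-nonneg : ∀ S → 0ℚ ≤ u S
  u-nonneg S = subst (_≤ u S) (E-const pr 0ℚ) (E-mono pr (λ r → ⟦⟧-nonneg (sumS S r ℕ.<? k)))

  u≤1 : ∀ S → u S ≤ 1ℚ
  u≤1 S = subst (u S ≤_) (E-const pr 1ℚ) (E-mono pr (λ r → ⟦⟧-≤1 (sumS S r ℕ.<? k)))

  module _ {S₀ : Subset n} {π : Policy n} (nr : NoRepeat S₀ π) where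

    runFails : Vec ℕ n → ℚ
    runFails r = short (setOf (run π r)) r

    q : ℚ
    q = E D runFails

    module _ (S : Subset n) where

      q∣ : Vec ℕ n → ℚ
      q∣ ρ = E D (λ r → runFails (mix S ρ r))

      -- Still short, while the tree is likely enough to succeed for `Round.covers` under the pinned
      -- law.
      Good : Vec ℕ n → Set
      Good ρ = sumS S ρ ℕ.< k × q∣ ρ ≤ ¼

      good? : ∀ ρ → Dec (Good ρ)
      good? ρ = (sumS S ρ ℕ.<? k) ×-dec (q∣ ρ ≤? ¼)

      early? : ∀ t ρ → Dec (Good ρ × sumS S ρ ℕ.< t)
      early? t ρ = good? ρ ×-dec (sumS S ρ ℕ.<? t)

      q∣-nonneg : ∀ ρ → 0ℚ ≤ q∣ ρ
      q∣-nonneg ρ = subst (_≤ q∣ ρ) (E-const pr 0ℚ)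
        (E-mono pr (λ r → ⟦⟧-nonneg (sumS (setOf (run π (mix S ρ r))) (mix S ρ r) ℕ.<? k)))

      -- A short outcome that is not good has conditional failure probability above `¼`.
      markov : ∀ ρ → short S ρ ≤ ⟦ good? ρ ⟧ + 4ℚ * q∣ ρ
      markov ρ = ⟦⟧-bound (sumS S ρ ℕ.<? k) (⟦⟧-nonneg (good? ρ) ⊕ 0≤4 ⊛ q∣-nonneg ρ) bound
        where
        bound : sumS S ρ ℕ.< k → 1ℚ ≤ ⟦ good? ρ ⟧ + 4ℚ * q∣ ρ
        bound lt = helper (q∣ ρ ≤? ¼)
          where
          helper : Dec (q∣ ρ ≤ ¼) → 1ℚ ≤ ⟦ good? ρ ⟧ + 4ℚ * q∣ ρ
          helper (yes q≤) = ≤-by (0≤4 ⊛ q∣-nonneg ρ) (cong (_+ 4ℚ * q∣ ρ) (⟦⟧-true (good? ρ) (lt , q≤)))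
          helper (no  q≰) = ≤-trans (subst (_≤ 4ℚ * q∣ ρ) 4¼≡1 (*-monoˡ-≤ 0≤4 (<⇒≤ (≰⇒> q≰))))
            (≤-by (⟦⟧-nonneg (good? ρ)) (+-comm ⟦ good? ρ ⟧ (4ℚ * q∣ ρ)))

      goodMass : ℚ
      goodMass = E D (λ ρ → ⟦ good? ρ ⟧)

      u≤good+4q : u S ≤ goodMass + 4ℚ * q
      u≤good+4q = subst (u S ≤_) eq (E-mono pr markov)
        where
        eq : E D (λ ρ → ⟦ good? ρ ⟧ + 4ℚ * q∣ ρ) ≡ goodMass + 4ℚ * q
        eq = trans (E-+ D (λ ρ → ⟦ good? ρ ⟧) (λ ρ → 4ℚ * q∣ ρ))
          (cong (goodMass +_) (trans (E-* D 4ℚ q∣) (cong (4ℚ *_) (E-mix S pr runFails))))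

      Improves : Set
      Improves = ∃ λ ps → length ps ℕ.≤ rounds ℕ.+ suc rounds × All (λ p → ∃ λ r → p ≡ run π r) ps ×
        u (S ∪ setOf (concat ps)) ≤ ¾ * u S + q

      -- The tour found for the good outcome ρ of S with the largest deficit serves all good outcomes.
      serve : ∀ t ρ → Good ρ → sumS S ρ ℕ.≤ t → E D (λ r → ⟦ early? t r ⟧) ≤ 0ℚ → Improves
      serve t ρ (_ , q≤¼) ρ≤t none-early = finish covered
        where
        covered : Round.Covers (pin-isProb S ρ pr) nr k
        covered = Round.covers (pin-isProb S ρ pr) nr k (subst (_≤ ¼) (sym (E-pin S ρ D runFails pr)) q≤¼)
        finish : Round.Covers (pin-isProb S ρ pr) nr k → Improves
        finish (ps , len , runs , N≤¾) = ps , len , runs , bound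
          where
          N : Subset n
          N = setOf (concat ps)
          after : Vec ℕ n → ℚ
          after r = E D (λ r′ → short (S ∪ N) (mix S r r′))
          after≤1 : ∀ r → after r ≤ 1ℚ
          after≤1 r = subst (after r ≤_) (E-const pr 1ℚ) (E-mono pr (λ r′ → ⟦⟧-≤1 (sumS (S ∪ N) (mix S r r′) ℕ.<? k)))
          -- The paths succeed often enough with the rewards `ρ` on `S`, hence also with `r`, which
          -- carries no less there; the fresh part on `N ─ S` is the same in both cases.
          after≤¾ : ∀ r → t ℕ.≤ sumS S r → after r ≤ ¾
          after≤¾ r t≤r = ≤-trans (E-mono pr λ r′ →
              ⟦⟧-mono (sumS (S ∪ N) (mix S r r′) ℕ.<? k) (sumS N (mix S ρ r′) ℕ.<? k) (ℕₚ.≤-<-trans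
                (ℕₚ.≤-trans (sumS-∪≥ʳ S N (mix S ρ r′)) (subst₂ ℕ._≤_ (sym (sumS-mix S N ρ r′)) (sym (sumS-mix S N r r′))
                  (ℕₚ.+-monoˡ-≤ (sumS (N ─ S) r′) (ℕₚ.≤-trans ρ≤t t≤r))))))
            (subst (_≤ ¾) (E-pin S ρ D (short N) pr) N≤¾)
          after≡0 : ∀ r → k ℕ.≤ sumS S r → after r ≡ 0ℚ
          after≡0 r k≤r = trans (E-cong D (λ r′ → ⟦⟧-false (sumS (S ∪ N) (mix S r r′) ℕ.<? k)
              (ℕₚ.≤⇒≯ (subst (k ℕ.≤_) (sym (sumS-mix S N r r′)) (ℕₚ.m≤n⇒m≤n+o (sumS (N ─ S) r′) k≤r)))))
            (E-const pr 0ℚ)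
          pointwise : ∀ r → after r ≤ short S r + (- ¼) * ⟦ good? r ⟧ + ⟦ early? t r ⟧
          pointwise r = charge (sumS S r ℕ.<? k) (good? r) (early? t r) (after≤1 r)
            (λ r≮k → ≤-reflexive (after≡0 r (ℕₚ.≮⇒≥ r≮k))) proj₁
            (λ g ¬early → after≤¾ r (ℕₚ.≮⇒≥ λ r<t → ¬early (g , r<t)))
          total : u (S ∪ N) ≤ u S + (- ¼) * goodMass + E D (λ r → ⟦ early? t r ⟧)
          total = subst₂ _≤_ (E-mix S pr (short (S ∪ N)))
            (trans (E-+₃ D (short S) (λ r → (- ¼) * ⟦ good? r ⟧) (λ r → ⟦ early? t r ⟧))
                   (cong (λ z → u S + z + E D (λ r → ⟦ early? t r ⟧)) (E-* D (- ¼) (λ r → ⟦ good? r ⟧))))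
            (E-mono pr pointwise)
          -- Comes from inserting `goodMass ≥ u S - 4 q` into `u S - ¼ goodMass`.
          bound : u (S ∪ N) ≤ ¾ * u S + q
          bound = ≤-trans total (≤-by (diff≥0 none-early ⊕ 0≤¼ ⊛ diff≥0 u≤good+4q)
            (trans (cong₂ _+_ (cong (_* u S) ¾≡1-¼) (trans (sym (*-identityˡ q)) (cong (_* q) (sym 4¼≡1))))
                   (lemma ¼ 4ℚ (u S) q goodMass (E D (λ r → ⟦ early? t r ⟧)))))
            where
            lemma : ∀ c f u q g e → (1ℚ - c) * u + (f * c) * q ≡
              (u + (- c) * g + e) + ((0ℚ - e) + c * ((g + f * q) - u))
            lemma = solve-∀ ℚ-ring

      NoneEarly : ℕ → Set
      NoneEarly t = E D (λ r → ⟦ early? t r ⟧) ≤ 0ℚ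

      opaque
        improve : Improves
        improve with u S ≤? 4ℚ * q
        -- The empty round suffices, as `¼ u S ≤ q`.
        ... | yes u≤4q = [] , ℕ.z≤n , [] , subst (λ T → u T ≤ ¾ * u S + q) (sym (∪-identityʳ S))
          (≤-by (0≤¼ ⊛ diff≥0 u≤4q) (trans (cong (λ z → ¾ * u S + z) (sym (*-identityˡ q)))
            (trans (cong (λ z → ¾ * u S + z * q) (sym 4¼≡1)) (trans (lemma ¼ 4ℚ ¾ (u S) q) (cong (_+ ¼ * (4ℚ * q - u S)) (sym (¼-split (u S))))))))
          where
          lemma : ∀ c f d u q → d * u + (f * c) * q ≡ (d * u + c * u) + c * (f * q - u)
          lemma = solve-∀ ℚ-ring
        -- Now good outcomes have positive mass. The first failure of `NoneEarly` locates the least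
        -- reward below `k` at which they do.
        ... | no u≰4q = search (first-failure (λ t → E D (λ r → ⟦ early? t r ⟧) ≤? 0ℚ) none₀ k ¬noneₖ)
          where
          none₀ : NoneEarly 0
          none₀ = ≤-reflexive (trans (E-cong D (λ r → ⟦⟧-false (early? 0 r) (λ ()))) (E-const pr 0ℚ))
          ¬noneₖ : ¬ NoneEarly k
          ¬noneₖ none = u≰4q (≤-trans u≤good+4q (≤-by (diff≥0 (≤-trans
            (E-mono pr (λ r → ⟦⟧-mono (good? r) (early? k r) (λ g → g , proj₁ g))) none))
            (lemma goodMass (4ℚ * q))))
            where
            lemma : ∀ g f → f ≡ (g + f) + (0ℚ - g)
            lemma = solve-∀ ℚ-ring
          search : (∃ λ t → NoneEarly t × ¬ NoneEarly (suc t)) → Improves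
          search (t , none , ¬none) = pick (E-attains-≥ pr (λ r → ⟦ early? (suc t) r ⟧))
            where
            pick : (∃ λ r → Supp D r × E D (λ r → ⟦ early? (suc t) r ⟧) ≤ ⟦ early? (suc t) r ⟧) → Improves
            pick (ρ , _ , le) with early? (suc t) ρ
            ... | yes (g , lt) = serve t ρ g (ℕₚ.≤-pred lt) none
            ... | no _ = ⊥-elim (¬none le)

-- Geometric budgets

ι-mono : ∀ {m n} → m ℕ.≤ n → ι m ≤ ι n
ι-mono {n = n} ℕ.z≤n = ι-nonneg n
ι-mono (ℕ.s≤s m≤n)   = +-monoʳ-≤ 1ℚ (ι-mono m≤n)

opaque
  archimedean : ∀ x → ∃ λ N → x ≤ ι N
  archimedean x@(mkℚ p q-1 _) = ℤ.∣ p ∣ , subst (x ≤_) (ι≡ ℤ.∣ p ∣) (*≤* le)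
    where
    whole : ℕ → ℚ
    whole N = mkℚ (ℤ.+ N) 0 (coprime-sym (1-coprimeTo N))
    ι≡ : ∀ N → whole N ≡ ι N
    ι≡ zero    = refl
    ι≡ (suc N) = trans (toℚᵘ-injective (ℚᵘₚ.≃-trans (ℚᵘ.*≡* numerators) (ℚᵘₚ.≃-sym (toℚᵘ-homo-+ 1ℚ (whole N)))))
                       (cong (1ℚ +_) (ι≡ N))
      where
      numerators : ℤ.+ suc N ℤ.* ℤ.+ 1 ≡ (ℤ.+ 1 ℤ.* ℤ.+ 1 ℤ.+ ℤ.+ N ℤ.* ℤ.+ 1) ℤ.* ℤ.+ 1
      numerators = trans (ℤₚ.*-identityʳ (ℤ.+ suc N)) (sym (trans (ℤₚ.*-identityʳ (ℤ.+ 1 ℤ.* ℤ.+ 1 ℤ.+ ℤ.+ N ℤ.* ℤ.+ 1))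
        (cong (ℤ._+_ (ℤ.+ 1)) (ℤₚ.*-identityʳ (ℤ.+ N)))))
    le : p ℤ.* ℤ.+ 1 ℤ.≤ ℤ.+ ℤ.∣ p ∣ ℤ.* ℤ.+ suc q-1
    le = ℤₚ.≤-trans (ℤₚ.≤-reflexive (ℤₚ.*-identityʳ p)) (ℤₚ.≤-trans (p≤∣p∣ p)
      (ℤₚ.≤-trans (ℤ.+≤+ (ℕₚ.m≤m*n ℤ.∣ p ∣ (suc q-1))) (ℤₚ.≤-reflexive (ℤₚ.pos-* ℤ.∣ p ∣ (suc q-1)))))
      where
      p≤∣p∣ : ∀ p → p ℤ.≤ ℤ.+ ℤ.∣ p ∣
      p≤∣p∣ (ℤ.+ _)     = ℤₚ.≤-refl
      p≤∣p∣ ℤ.-[1+ _ ] = ℤ.-≤+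

opaque
  unfolding 2ℚ θ

  -- A round costs `K B u` and leaves `u′ ≤ ¾ u + q`. The potential `16 K B u` pays for this because
  -- `16 = 1 + 16 · β · ¾`, and `20 = 16 β` is the price of `q`. The 5 is `β / (β - 1)`, from the
  -- geometric series.
  β 5ℚ 16ℚ 20ℚ : ℚ
  β   = 1ℚ + ¼
  5ℚ  = ℤ.+ 5 / 1
  16ℚ = ℤ.+ 16 / 1
  20ℚ = ℤ.+ 20 / 1

  β≡1+¼ : β ≡ 1ℚ + ¼
  β≡1+¼ = refl

  0≤β-1 : 0ℚ ≤ β - 1ℚ
  0≤β-1 = from-yes (0ℚ ≤? β - 1ℚ)

  0≤5 : 0ℚ ≤ 5ℚ
  0≤5 = from-yes (0ℚ ≤? 5ℚ)

  0≤16 : 0ℚ ≤ 16ℚ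
  0≤16 = from-yes (0ℚ ≤? 16ℚ)

  0≤20 : 0ℚ ≤ 20ℚ
  0≤20 = from-yes (0ℚ ≤? 20ℚ)

  1≤16 : 1ℚ ≤ 16ℚ
  1≤16 = from-yes (1ℚ ≤? 16ℚ)

  ¼>0 : 0ℚ < ¼
  ¼>0 = from-yes (0ℚ <? ¼)

  geo-arith₀ : ∀ B ℓ → 5ℚ * ℓ - (2ℚ + 2ℚ) * B ≡ 0ℚ + (2ℚ + 2ℚ) * (β * ℓ - B)
  geo-arith₀ = solve-∀ ℚ-ring

  geo-arith₁ : ∀ B ℓ → 5ℚ * ℓ - (2ℚ + 2ℚ) * B ≡ B * 1ℚ + (5ℚ * ℓ - (2ℚ + 2ℚ) * (β * B))
  geo-arith₁ = solve-∀ ℚ-ring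

  phase-arith : ∀ K B u u′ q Q G →
    16ℚ * K * B * u + 20ℚ * K * (B * Q + G) ≡
      (K * B * u + (16ℚ * K * (β * B) * u′ + 20ℚ * K * G)) +
      (20ℚ * K * B * (¾ * u + q - u′) + 20ℚ * K * B * (Q - q))
  phase-arith = solve-∀ ℚ-ring

0≤β : 0ℚ ≤ β
0≤β = ≤-trans 0≤1 (≤-by 0≤β-1 (lemma β))
  where
  lemma : ∀ b → b ≡ 1ℚ + (b - 1ℚ)
  lemma = solve-∀ ℚ-ring

x≤βx : ∀ {x} → 0ℚ ≤ x → x ≤ β * x
x≤βx {x} 0≤x = ≤-by (0≤β-1 ⊛ 0≤x) (lemma β x)
  where
  lemma : ∀ b x → b * x ≡ x + (b - 1ℚ) * x
  lemma = solve-∀ ℚ-ring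

-- Taken in expectation over `ℓ`, each of `j` budgets is weighted by the probability that the
-- optimum does not finish within it.
geo : ℕ → ℚ → ℚ → ℚ
geo zero    B ℓ = 0ℚ
geo (suc j) B ℓ = B * ⟦ B <? ℓ ⟧ + geo j (β * B) ℓ

geo-nonneg : ∀ j {B} ℓ → 0ℚ ≤ B → 0ℚ ≤ geo j B ℓ
geo-nonneg zero        ℓ 0≤B = ≤-refl
geo-nonneg (suc j) {B} ℓ 0≤B = 0≤B ⊛ ⟦⟧-nonneg (B <? ℓ) ⊕ geo-nonneg j ℓ (0≤β ⊛ 0≤B)

geo-late : ∀ j {B ℓ} → 0ℚ ≤ B → ℓ ≤ B → geo j B ℓ ≡ 0ℚ
geo-late zero            0≤B ℓ≤B = refl
geo-late (suc j) {B} {ℓ} 0≤B ℓ≤B = trans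
  (cong₂ (λ i g → B * i + g) (⟦⟧-false (B <? ℓ) (λ B<ℓ → <-irrefl refl (<-≤-trans B<ℓ ℓ≤B))) (geo-late j (0≤β ⊛ 0≤B) (≤-trans ℓ≤B (x≤βx 0≤B))))
  (trans (+-identityʳ (B * 0ℚ)) (*-zeroʳ B))

-- The budgets below `ℓ` sum to `4 (M - B)`, where `M` is the next one after them and is at most
-- `β ℓ`. Keeping the term `- 4 B` makes the induction close.
geo-early : ∀ j {B ℓ} → 0ℚ ≤ B → B ≤ β * ℓ → geo j B ℓ ≤ 5ℚ * ℓ - (2ℚ + 2ℚ) * B
geo-early zero {B} {ℓ} 0≤B B≤βℓ = ≤-by ((0≤2 ⊕ 0≤2) ⊛ diff≥0 B≤βℓ) (geo-arith₀ B ℓ)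
geo-early (suc j) {B} {ℓ} 0≤B B≤βℓ = go (B <? ℓ)
  where
  go : (d : Dec (B < ℓ)) → B * ⟦ d ⟧ + geo j (β * B) ℓ ≤ 5ℚ * ℓ - (2ℚ + 2ℚ) * B
  go (yes B<ℓ) = subst (B * 1ℚ + geo j (β * B) ℓ ≤_) (sym (geo-arith₁ B ℓ))
    (+-monoʳ-≤ (B * 1ℚ) (geo-early j (0≤β ⊛ 0≤B) (*-monoˡ-≤ 0≤β (<⇒≤ B<ℓ))))
  go (no B≮ℓ) = subst (_≤ 5ℚ * ℓ - (2ℚ + 2ℚ) * B)
    (sym (cong₂ _+_ (*-zeroʳ B) (geo-late j (0≤β ⊛ 0≤B) (≤-trans (≮⇒≥ B≮ℓ) (x≤βx 0≤B)))))
    (≤-by ((0≤2 ⊕ 0≤2) ⊛ diff≥0 B≤βℓ) (geo-arith₀ B ℓ))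

geo-bound : ∀ j {B ℓ} → 0ℚ ≤ B → 0ℚ ≤ ℓ → geo j B ℓ ≤ 5ℚ * ℓ
geo-bound j {B} {ℓ} 0≤B 0≤ℓ = go (B ≤? β * ℓ)
  where
  lemma : ∀ a b → a ≡ (a - b) + b
  lemma = solve-∀ ℚ-ring
  go : Dec (B ≤ β * ℓ) → geo j B ℓ ≤ 5ℚ * ℓ
  go (yes B≤βℓ) = ≤-trans (geo-early j 0≤B B≤βℓ) (≤-by ((0≤2 ⊕ 0≤2) ⊛ 0≤B) (lemma (5ℚ * ℓ) ((2ℚ + 2ℚ) * B)))
  go (no  B≰βℓ) = subst (_≤ 5ℚ * ℓ) (sym (geo-late j 0≤B (≤-trans (x≤βx 0≤ℓ) (<⇒≤ (≰⇒> B≰βℓ))))) (0≤5 ⊛ 0≤ℓ)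


opaque
  -- Bernoulli's inequality gives `β ^ N ≥ 1 + N / 4`.
  enough-phases : ∀ x {b} → 0ℚ < b → ∃ λ j → x ≤ b * β ^ j
  enough-phases x {b} 0<b = finish (archimedean (x * (1/ c) {{nz}}))
    where
    c : ℚ
    c = b * ¼
    c>0 : Positive c
    c>0 = pos*pos⇒pos b {{positive 0<b}} ¼ {{positive ¼>0}}
    nz : NonZero c
    nz = pos⇒nonZero c {{c>0}}
    finish : (∃ λ N → x * (1/ c) {{nz}} ≤ ι N) → ∃ λ j → x ≤ b * β ^ j
    finish (N , le) = N , ≤-trans (subst (_≤ c * ι N) cancel (*-monoˡ-≤ (<⇒≤ (positive⁻¹ c {{c>0}})) le))
      (≤-trans (≤-by (<⇒≤ 0<b) (lemma b ¼ (ι N)))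
        (*-monoˡ-≤ (<⇒≤ 0<b) (subst (λ z → 1ℚ + ι N * ¼ ≤ z ^ N) (sym β≡1+¼) (bernoulli⁺ N 0≤¼))))
      where
      cancel : c * (x * (1/ c) {{nz}}) ≡ x
      cancel = trans (lemma′ c x ((1/ c) {{nz}})) (trans (cong (x *_) (*-inverseʳ c {{nz}})) (*-identityʳ x))
        where
        lemma′ : ∀ c x i → c * (x * i) ≡ x * (c * i)
        lemma′ = solve-∀ ℚ-ring
      lemma : ∀ b c i → b * (1ℚ + i * c) ≡ (b * c) * i + b
      lemma = solve-∀ ℚ-ring

-- Sets of visited vertices

Full : ∀ {n} → Subset n → Set
Full T = ∀ v → lookup T v ≡ true

full? : ∀ {n} (T : Subset n) → Dec (Full T)
full? T = Finₚ.all? (λ v → lookup T v Boolₚ.≟ true)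

lookup-⊥ : ∀ {n} (v : Fin n) → lookup ⊥ v ≡ false
lookup-⊥ zero    = refl
lookup-⊥ (suc v) = lookup-⊥ v

lookup-insert⁻ : ∀ {n} (S : Subset n) v w → lookup (S [ v ]≔ true) w ≡ true → w ≡ v ⊎ lookup S w ≡ true
lookup-insert⁻ S v w h with w Finₚ.≟ v
... | yes w≡v = inj₁ w≡v
... | no  w≢v = inj₂ (trans (sym (lookup-≔-≢ S w v true w≢v)) h)

∈-setOf⁻ : ∀ {n} (σ : List (Fin n)) {w} → lookup (setOf σ) w ≡ true → w ∈ σ
∈-setOf⁻ [] {w} h = case trans (sym (lookup-⊥ w)) h of λ ()
∈-setOf⁻ (v ∷ σ) {w} h with lookup-insert⁻ (setOf σ) v w h
... | inj₁ refl = here refl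
... | inj₂ h′   = there (∈-setOf⁻ σ h′)

insert-∪ˡ : ∀ {n} (S T : Subset n) v → (S [ v ]≔ true) ∪ T ≡ S ∪ (T [ v ]≔ true)
insert-∪ˡ (s ∷ S) (t ∷ T) zero    = cong (_∷ (S ∪ T)) (sym (Boolₚ.∨-zeroʳ s))
insert-∪ˡ (s ∷ S) (t ∷ T) (suc v) = cong (_ ∷_) (insert-∪ˡ S T v)

insert-idem : ∀ {n} (S : Subset n) v → lookup S v ≡ true → S [ v ]≔ true ≡ S
insert-idem (true ∷ S) zero    h = refl
insert-idem (s ∷ S)    (suc v) h = cong (s ∷_) (insert-idem S v h)

sumS-insert-≤ : ∀ {n} (S : Subset n) v r → sumS S r ℕ.≤ sumS (S [ v ]≔ true) r
sumS-insert-≤ (true  ∷ S) zero    (a ∷ r) = ℕₚ.≤-refl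
sumS-insert-≤ (false ∷ S) zero    (a ∷ r) = ℕₚ.m≤n+m (sumS S r) a
sumS-insert-≤ (true  ∷ S) (suc v) (a ∷ r) = ℕₚ.+-monoʳ-≤ a (sumS-insert-≤ S v r)
sumS-insert-≤ (false ∷ S) (suc v) (a ∷ r) = sumS-insert-≤ S v r

Distinct : ∀ {n} → Subset n → List (Fin n) → Set
Distinct S []      = ⊤
Distinct S (v ∷ σ) = lookup S v ≡ false × Distinct (S [ v ]≔ true) σ

distinct-unique : ∀ {n} (S : Subset n) σ → Distinct S σ → All (λ w → lookup S w ≡ false) σ × Unique σ
distinct-unique S []      _         = [] , []
distinct-unique S (v ∷ σ) (v∉S , d) with distinct-unique (S [ v ]≔ true) σ d
... | avoid , uniq = v∉S ∷ All.map proj₂ split , All.map proj₁ split ∷ uniq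
  where
  v≢ : ∀ w → lookup (S [ v ]≔ true) w ≡ false → v ≢ w
  v≢ w h refl = case trans (sym (lookup-insert S v)) h of λ ()
  split : All (λ w → v ≢ w × lookup S w ≡ false) σ
  split = All.map (λ {w} h → v≢ w h , trans (sym (lookup-≔-≢ S w v true (v≢ w h ∘ sym))) h) avoid

dedup : ∀ {n} → Subset n → List (Fin n) → List (Fin n)
dedup S []      = []
dedup S (v ∷ σ) = if lookup S v then dedup S σ else v ∷ dedup (S [ v ]≔ true) σ

dedup-distinct : ∀ {n} (S : Subset n) σ → Distinct S (dedup S σ)
dedup-distinct S []      = tt
dedup-distinct S (v ∷ σ) with lookup S v in eq
... | true  = dedup-distinct S σ
... | false = eq , dedup-distinct (S [ v ]≔ true) σ

dedup-∈ : ∀ {n} (S : Subset n) σ {w} → w ∈ σ → lookup S w ≡ true ⊎ w ∈ dedup S σ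
dedup-∈ S (v ∷ σ) w∈ with lookup S v in eq
dedup-∈ S (v ∷ σ) (here refl) | true  = inj₁ eq
dedup-∈ S (v ∷ σ) (there w∈)  | true  = dedup-∈ S σ w∈
dedup-∈ S (v ∷ σ) (here refl) | false = inj₂ (here refl)
dedup-∈ S (v ∷ σ) {w} (there w∈) | false with dedup-∈ (S [ v ]≔ true) σ w∈
... | inj₂ w∈′ = inj₂ (there w∈′)
... | inj₁ h with lookup-insert⁻ S v w h
...   | inj₁ refl = inj₂ (here refl)
...   | inj₂ h′   = inj₁ h′

-- Cuts the tree at a repeated vertex, so that `NoRepeat` holds on all branches. A valid policy
-- repeats at most on branches of unlisted rewards, so its expected cost is the same.
norm : ∀ {n} → Subset n → Policy n → Policy n
norm S stop        = stop
norm S (visit v f) = if lookup S v then stop else visit v (λ a → norm (S [ v ]≔ true) (f a))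

norm-noRepeat : ∀ {n} (S : Subset n) π → NoRepeat S (norm S π)
norm-noRepeat S stop = tt
norm-noRepeat S (visit v f) with lookup S v in eq
... | true  = tt
... | false = eq , λ a → norm-noRepeat (S [ v ]≔ true) (f a)

-- Tours

-- The number of paths allowed per round, times 2 for walking out and back.
K : ℚ
K = ι (rounds ℕ.+ suc rounds) * 2ℚ

0≤K : 0ℚ ≤ K
0≤K = ι-nonneg (rounds ℕ.+ suc rounds) ⊛ 0≤2

2≤16K : 2ℚ ≤ 16ℚ * K
2≤16K = ≤-trans 2≤K (subst (_≤ 16ℚ * K) (*-identityˡ K) (*-monoʳ-≤ 0≤K 1≤16))
  where
  1≤ι : 1ℚ ≤ ι (rounds ℕ.+ suc rounds)
  1≤ι = ≤-trans (≤-reflexive (sym (+-identityʳ 1ℚ))) (ι-mono {1} (ℕₚ.≤-trans (ℕ.s≤s ℕ.z≤n) (ℕₚ.m≤n+m (suc rounds) rounds)))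
  2≤K : 2ℚ ≤ K
  2≤K = subst (_≤ K) (*-identityˡ 2ℚ) (*-monoʳ-≤ 0≤2 1≤ι)

module Tours {n} (I : Instance n) where
  open Instance I
  open IsMetric isMetric

  pr : ∀ v → IsProb (dist v)
  pr v = record { nonneg = prob-nonneg v ; total = prob-sum v }

  open Progress pr k public

  len : Fin n → List (Fin n) → ℚ
  len cur []      = 0ℚ
  len cur (v ∷ p) = d cur v + len v p

  len-nonneg : ∀ cur p → 0ℚ ≤ len cur p
  len-nonneg cur []      = ≤-refl
  len-nonneg cur (v ∷ p) = nonneg cur v ⊕ len-nonneg v p

  -- The recursive cost draws a reward at each visit, `E` draws all of them once; without repetition
  -- `E-run` identifies the two.
  expCost-run : ∀ {S} cur π → NoRepeat S π → expCostFrom I cur π ≡ E dist (λ r → len cur (run π r))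
  expCost-run cur stop nr = sym (E-const pr 0ℚ)
  expCost-run cur (visit v f) nr = sym (begin
    E dist (λ r → len cur (run (visit v f) r))
      ≡⟨ E-run pr nr (λ p _ → len cur p) ⟩
    expect (dist v) (λ a → E dist (λ r → d cur v + len v (run (f a) r)))
      ≡⟨ expect-cong (dist v) (λ a → trans (E-+ dist (λ _ → d cur v) (λ r → len v (run (f a) r)))
           (cong₂ _+_ (E-const pr (d cur v)) (sym (expCost-run v (f a) (proj₂ nr a))))) ⟩
    expect (dist v) (λ a → d cur v + expCostFrom I v (f a))
      ≡⟨ trans (expect-+ (dist v) (λ _ → d cur v) (λ a → expCostFrom I v (f a))) (cong (_+ _) (expect-const (pr v) (d cur v))) ⟩
    d cur v + expect (dist v) (λ a → expCostFrom I v (f a)) ∎)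
    where open ≡-Reasoning

  trunc : ℚ → Fin n → Policy n → Policy n
  trunc B cur stop        = stop
  trunc B cur (visit v f) with d cur v ≤? B
  ... | yes _ = visit v (λ a → trunc (B - d cur v) v (f a))
  ... | no  _ = stop

  trunc-noRepeat : ∀ {S} B cur π → NoRepeat S π → NoRepeat S (trunc B cur π)
  trunc-noRepeat B cur stop        nr = tt
  trunc-noRepeat B cur (visit v f) (v∉S , nr) with d cur v ≤? B
  ... | yes _ = v∉S , λ a → trunc-noRepeat (B - d cur v) v (f a) (nr a)
  ... | no  _ = tt

  trunc-len : ∀ B cur π r → 0ℚ ≤ B → len cur (run (trunc B cur π) r) ≤ B
  trunc-len B cur stop        r 0≤B = 0≤B
  trunc-len B cur (visit v f) r 0≤B with d cur v ≤? B
  ... | no  _   = 0≤B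
  ... | yes d≤B = ≤-by (diff≥0 (trunc-len (B - d cur v) v (f (lookup r v)) r (diff≥0 d≤B)))
    (lemma B (d cur v) (len v (run (trunc (B - d cur v) v (f (lookup r v))) r)))
    where
    lemma : ∀ B d l → B ≡ (d + l) + ((B - d) - l)
    lemma = solve-∀ ℚ-ring

  trunc-run : ∀ B cur π r → len cur (run π r) ≤ B → run (trunc B cur π) r ≡ run π r
  trunc-run B cur stop        r h = refl
  trunc-run B cur (visit v f) r h with d cur v ≤? B
  ... | yes d≤B = cong (v ∷_) (trunc-run (B - d cur v) v (f (lookup r v)) r
    (≤-by (diff≥0 h) (lemma B (d cur v) (len v (run (f (lookup r v)) r)))))
    where
    lemma : ∀ B d l → B - d ≡ l + (B - (d + l))
    lemma = solve-∀ ℚ-ring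
  ... | no  d≰B = ⊥-elim (d≰B (≤-trans (≤-by (len-nonneg v (run (f (lookup r v)) r)) refl) h))

  expCost-norm : ∀ {acc vs S} cur π → ValidFrom I acc vs π → (∀ v → lookup S v ≡ true → v ∈ vs) →
    expCostFrom I cur (norm S π) ≡ expCostFrom I cur π
  expCost-norm cur stop val S⊆vs = refl
  expCost-norm {S = S} cur (visit v f) (_ , v∉vs , val) S⊆vs with lookup S v in eq
  ... | true  = ⊥-elim (v∉vs (S⊆vs v eq))
  ... | false = cong (d cur v +_) (expect-cong-∈ (dist v) (λ a∈ → expCost-norm v (f _) (val a∈) S′⊆))
    where
    S′⊆ : ∀ w → lookup (S [ v ]≔ true) w ≡ true → w ∈ v ∷ _
    S′⊆ w h with lookup-insert⁻ S v w h
    ... | inj₁ refl = here refl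
    ... | inj₂ h′   = there (S⊆vs w h′)

  -- `S` mirrors the visited list `vs` and `acc` its reward. `Supp` keeps the run on listed
  -- branches, so validity applies at the leaf that is reached.
  outcome : ∀ {acc vs} S π r → ValidFrom I acc vs π → (∀ v → lookup S v ≡ true → v ∈ vs) →
    (∀ v → v ∈ vs → lookup S v ≡ true) → acc ≡ sumS S r → Supp dist r →
    k ℕ.≤ sumS (S ∪ setOf (run (norm S π) r)) r ⊎ Full (S ∪ setOf (run (norm S π) r))
  outcome S stop r val S⊆vs vs⊆S acc≡ supp rewrite ∪-identityʳ S with val
  ... | inj₁ k≤acc = inj₁ (subst (k ℕ.≤_) acc≡ k≤acc)
  ... | inj₂ all   = inj₂ (λ v → vs⊆S v (all v))
  outcome {acc} {vs} S (visit v f) r (_ , v∉vs , val) S⊆vs vs⊆S acc≡ supp with lookup S v in eq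
  ... | true  = ⊥-elim (v∉vs (S⊆vs v eq))
  ... | false = subst (λ T → k ℕ.≤ sumS T r ⊎ Full T) (insert-∪ˡ S _ v)
    (outcome (S [ v ]≔ true) (f (lookup r v)) r (val (proj₂ (supp v))) S′⊆ ⊆S′
      (trans (cong (ℕ._+ lookup r v) acc≡) (sym (sumS-insert S v r eq))) supp)
    where
    S′⊆ : ∀ w → lookup (S [ v ]≔ true) w ≡ true → w ∈ v ∷ vs
    S′⊆ w h with lookup-insert⁻ S v w h
    ... | inj₁ refl = here refl
    ... | inj₂ h′   = there (S⊆vs w h′)
    ⊆S′ : ∀ w → w ∈ v ∷ vs → lookup (S [ v ]≔ true) w ≡ true
    ⊆S′ w (here refl) = lookup-insert S v
    ⊆S′ w (there w∈)  = lookup-insert-mono S w v (vs⊆S w w∈)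

  u-antitone : ∀ S T → u (S ∪ T) ≤ u S
  u-antitone S T = E-mono pr λ r → ⟦⟧-mono (sumS (S ∪ T) r ℕ.<? k) (sumS S r ℕ.<? k)
    (ℕₚ.≤-<-trans (subst (λ U → sumS S r ℕ.≤ sumS U r) (∪-comm T S) (sumS-∪≥ʳ T S r)))

  u-insert : ∀ S v → u (S [ v ]≔ true) ≤ u S
  u-insert S v = E-mono pr λ r → ⟦⟧-mono (sumS (S [ v ]≔ true) r ℕ.<? k) (sumS S r ℕ.<? k)
    (ℕₚ.≤-<-trans (sumS-insert-≤ S v r))

  -- A repeated vertex costs length but adds no reward.
  costL : Fin n → Subset n → List (Fin n) → ℚ
  costL cur S []      = 0ℚ
  costL cur S (v ∷ σ) = d cur v * u S + costL v (S [ v ]≔ true) σ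

  costL-detour : ∀ cur v S σ → costL cur S σ ≤ d cur v * u S + costL v S σ
  costL-detour cur v S []      = nonneg cur v ⊛ u-nonneg S ⊕ ≤-refl
  costL-detour cur v S (w ∷ σ) = ≤-by (u-nonneg S ⊛ diff≥0 (triangle cur v w))
    (lemma (d cur v) (d v w) (d cur w) (u S) (costL w (S [ w ]≔ true) σ))
    where
    lemma : ∀ a b c u t → a * u + (b * u + t) ≡ (c * u + t) + u * ((a + b) - c)
    lemma = solve-∀ ℚ-ring

  -- Skipping a repeated vertex is a shortcut that leaves the visited sets, and with them all
  -- weights `u`, unchanged.
  costL-dedup : ∀ cur S σ → costL cur S (dedup S σ) ≤ costL cur S σ
  costL-dedup cur S []      = ≤-refl
  costL-dedup cur S (v ∷ σ) with lookup S v in eq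
  ... | true  = ≤-trans (costL-detour cur v S (dedup S σ)) (+-monoʳ-≤ (d cur v * u S)
    (≤-trans (costL-dedup v S σ) (≤-reflexive (cong (λ T → costL v T σ) (sym (insert-idem S v eq))))))
  ... | false = +-monoʳ-≤ (d cur v * u S) (costL-dedup v (S [ v ]≔ true) σ)

  opaque
    unfolding 2ℚ

    -- All edges of `p` and the way back to the root have weight at most `u S`, since `u` decreases
    -- along the walk. The way back is at most `len cur p + d cur root`, which explains the 2.
    costL-++ : ∀ cur S p σ →
      costL cur S (p ++ σ) ≤ (2ℚ * len cur p + d cur root) * u S + costL root (S ∪ setOf p) σ
    costL-++ cur S [] σ = subst (λ T → costL cur S σ ≤ (2ℚ * 0ℚ + d cur root) * u S + costL root T σ) (sym (∪-identityʳ S))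
      (≤-trans (costL-detour cur root S σ) (≤-reflexive (lemma (d cur root) (u S) (costL root S σ))))
      where
      lemma : ∀ a u t → a * u + t ≡ ((1ℚ + 1ℚ) * 0ℚ + a) * u + t
      lemma = solve-∀ ℚ-ring
    costL-++ cur S (v ∷ p) σ = ≤-by
      (diff≥0 rest ⊕ (0≤2 ⊛ len-nonneg v p ⊕ nonneg v root) ⊛ diff≥0 (u-insert S v)
        ⊕ u-nonneg S ⊛ diff≥0 (subst (λ z → d v root ≤ z + d cur root) (symmetric v cur) (triangle v cur root)))
      (lemma (d cur v) (len v p) (d cur root) (d v root) (u S) (u (S [ v ]≔ true))
        (costL v (S [ v ]≔ true) (p ++ σ)) (costL root (S ∪ setOf (v ∷ p)) σ))
      where
      rest : costL v (S [ v ]≔ true) (p ++ σ)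
        ≤ (2ℚ * len v p + d v root) * u (S [ v ]≔ true) + costL root (S ∪ setOf (v ∷ p)) σ
      rest = subst (λ T → costL v (S [ v ]≔ true) (p ++ σ)
          ≤ (2ℚ * len v p + d v root) * u (S [ v ]≔ true) + costL root T σ)
        (insert-∪ˡ S (setOf p) v) (costL-++ v (S [ v ]≔ true) p σ)
      lemma : ∀ a l e g u w t z →
        ((1ℚ + 1ℚ) * (a + l) + e) * u + z ≡ (a * u + t) +
          ((((1ℚ + 1ℚ) * l + g) * w + z - t) + ((1ℚ + 1ℚ) * l + g) * (u - w) + u * ((a + e) - g))
      lemma = solve-∀ ℚ-ring

  costL-block : ∀ {B} S p σ → len root p ≤ B →
    costL root S (p ++ σ) ≤ 2ℚ * B * u S + costL root (S ∪ setOf p) σ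
  costL-block {B} S p σ p≤B = ≤-trans (costL-++ root S p σ) (+-monoˡ-≤ (costL root (S ∪ setOf p) σ)
    (*-monoʳ-≤ (u-nonneg S) (subst (λ z → 2ℚ * len root p + z ≤ 2ℚ * B) (sym (zero-diag root))
      (≤-trans (≤-reflexive (+-identityʳ (2ℚ * len root p))) (*-monoˡ-≤ 0≤2 p≤B)))))

  costL-blocks : ∀ {B} S ps σ → 0ℚ ≤ B → All (λ p → len root p ≤ B) ps →
    costL root S (concat ps ++ σ) ≤ ι (length ps) * (2ℚ * B * u S) + costL root (S ∪ setOf (concat ps)) σ
  costL-blocks {B} S [] σ 0≤B [] = ≤-reflexive (trans (cong (λ T → costL root T σ) (sym (∪-identityʳ S)))
    (lemma (2ℚ * B * u S) (costL root (S ∪ ⊥) σ)))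
    where
    lemma : ∀ b t → t ≡ 0ℚ * b + t
    lemma = solve-∀ ℚ-ring
  costL-blocks {B} S (p ∷ ps) σ 0≤B (p≤B ∷ ps≤B) = ≤-by
    (diff≥0 first ⊕ diff≥0 rest ⊕ ι-nonneg (length ps) ⊛ (0≤2 ⊛ 0≤B ⊛ diff≥0 (u-antitone S (setOf p))))
    (lemma (ι (length ps)) (2ℚ * B) (u S) (u S′) (costL root S ((p ++ concat ps) ++ σ))
      (costL root S′ (concat ps ++ σ)) (costL root (S ∪ setOf (p ++ concat ps)) σ))
    where
    S′ : Subset n
    S′ = S ∪ setOf p
    first : costL root S ((p ++ concat ps) ++ σ) ≤ 2ℚ * B * u S + costL root S′ (concat ps ++ σ)
    first = subst (λ τ → costL root S τ ≤ 2ℚ * B * u S + costL root S′ (concat ps ++ σ))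
      (sym (Listₚ.++-assoc p (concat ps) σ)) (costL-block S p (concat ps ++ σ) p≤B)
    cover : S′ ∪ setOf (concat ps) ≡ S ∪ setOf (p ++ concat ps)
    cover = trans (∪-assoc S (setOf p) (setOf (concat ps))) (cong (S ∪_) (sym (setOf-++ p (concat ps))))
    rest : costL root S′ (concat ps ++ σ) ≤
      ι (length ps) * (2ℚ * B * u S′) + costL root (S ∪ setOf (p ++ concat ps)) σ
    rest = subst (λ T → costL root S′ (concat ps ++ σ) ≤ ι (length ps) * (2ℚ * B * u S′) + costL root T σ)
      cover (costL-blocks S′ ps σ 0≤B ps≤B)
    lemma : ∀ i b u w t s z → (1ℚ + i) * (b * u) + z ≡
      t + (((b * u + s) - t) + ((i * (b * w) + z) - s) + i * (b * (u - w)))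
    lemma = solve-∀ ℚ-ring

  -- Phases played against a fixed valid policy.

  module _ (π : Policy n) (valid : ValidPolicy I π) where

    π′ : Policy n
    π′ = norm ⊥ π

    ⊥⊆[] : ∀ (v : Fin n) → lookup ⊥ v ≡ true → v ∈ []
    ⊥⊆[] v h = case trans (sym (lookup-⊥ v)) h of λ ()

    ℓ : Vec ℕ n → ℚ
    ℓ r = len root (run π′ r)

    expCost≡Eℓ : expCost I π ≡ E dist ℓ
    expCost≡Eℓ = trans (sym (expCost-norm root π valid ⊥⊆[])) (expCost-run root π′ (norm-noRepeat ⊥ π))

    reaches : ∀ r → Supp dist r → k ℕ.≤ sumS (setOf (run π′ r)) r ⊎ Full (setOf (run π′ r))
    reaches r supp = subst (λ T → k ℕ.≤ sumS T r ⊎ Full T) (∪-identityˡ (setOf (run π′ r)))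
      (outcome ⊥ π r valid ⊥⊆[] (λ v ()) (sym (sumS-⊥ r)) supp)

    G : ℕ → ℚ → ℚ
    G j B = E dist (λ r → geo j B (ℓ r))

    G-nonneg : ∀ j {B} → 0ℚ ≤ B → 0ℚ ≤ G j B
    G-nonneg j {B} 0≤B = subst (_≤ G j B) (E-const pr 0ℚ) (E-mono pr (λ r → geo-nonneg j (ℓ r) 0≤B))

    -- The first term is the potential paying for work at the present budget and failure
    -- probability; the second pays for failures of the optimum in the `j` phases to come.
    Plan : ℕ → ℚ → Subset n → Set
    Plan j B S = ∃ λ σ → (∀ v → v ∈ σ) × costL root S σ ≤ 16ℚ * K * B * u S + 20ℚ * K * G j B

    visit-all : ∀ j {B} S σ → 0ℚ ≤ B → (∀ v → v ∈ σ) → len root σ ≤ B → Plan j B S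
    visit-all j {B} S σ 0≤B σ∋ σ≤B = σ , σ∋ , (begin
      costL root S σ                       ≡⟨ cong (costL root S) (Listₚ.++-identityʳ σ) ⟨
      costL root S (σ ++ [])               ≤⟨ costL-block S σ [] σ≤B ⟩
      2ℚ * B * u S + 0ℚ                    ≤⟨ +-mono-≤ (*-monoʳ-≤ (u-nonneg S) (*-monoʳ-≤ 0≤B 2≤16K))
                                                       (0≤20 ⊛ 0≤K ⊛ G-nonneg j 0≤B) ⟩
      16ℚ * K * B * u S + 20ℚ * K * G j B  ∎)
      where open ≤-Reasoning

    module Phase (B : ℚ) (0≤B : 0ℚ ≤ B) where

      τ : Policy n
      τ = trunc B root π′

      τ-noRepeat : NoRepeat ⊥ τ
      τ-noRepeat = trunc-noRepeat B root π′ (norm-noRepeat ⊥ π)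

      completes : Vec ℕ n → ℚ
      completes r = ⟦ full? (setOf (run τ r)) ⟧

      late : Vec ℕ n → ℚ
      late r = ⟦ B <? ℓ r ⟧

      -- A run within the budget is not cut, so it reaches `k` or visits every vertex. The second
      -- case is genuine, as the total reward may stay below `k`.
      runFails-bound : ∀ r → Supp dist r → runFails τ-noRepeat r ≤ late r + completes r
      runFails-bound r supp = go (B <? ℓ r)
        where
        fails? : Dec (sumS (setOf (run τ r)) r ℕ.< k)
        fails? = sumS (setOf (run τ r)) r ℕ.<? k
        go : (b : Dec (B < ℓ r)) → ⟦ fails? ⟧ ≤ ⟦ b ⟧ + completes r
        go (yes _) = ≤-trans (⟦⟧-≤1 fails?) (≤-by (⟦⟧-nonneg (full? (setOf (run τ r)))) refl)
        go (no B≮ℓ) = ≤-trans (⟦⟧-mono fails? (full? (setOf (run τ r))) λ fails → case reached of λ where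
            (inj₁ k≤) → ⊥-elim (ℕₚ.≤⇒≯ k≤ fails)
            (inj₂ full) → full)
          (≤-reflexive (sym (+-identityˡ (completes r))))
          where
          reached : k ℕ.≤ sumS (setOf (run τ r)) r ⊎ Full (setOf (run τ r))
          reached = subst (λ p → k ℕ.≤ sumS (setOf p) r ⊎ Full (setOf p))
            (sym (trunc-run B root π′ r (≮⇒≥ B≮ℓ))) (reaches r supp)

      q-bound : E dist completes ≤ 0ℚ → q τ-noRepeat ≤ E dist late
      q-bound none = ≤-trans (E-mono-Supp pr runFails-bound) (≤-trans (≤-reflexive (E-+ dist late completes))
        (≤-by (diff≥0 none) (lemma (E dist late) (E dist completes))))
        where
        lemma : ∀ a b → a ≡ (a + b) + (0ℚ - b)
        lemma = solve-∀ ℚ-ring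

      run-len : ∀ {p} → (∃ λ r → p ≡ run τ r) → len root p ≤ B
      run-len (r , refl) = trunc-len B root π′ r 0≤B

      -- The paths of one round, each walked from the root and back, precede the plan for budget
      -- `β B`; `phase-arith` balances the potentials.
      next : ∀ j S → E dist completes ≤ 0ℚ → (∀ S′ → Plan j (β * B) S′) → Plan (suc j) B S
      next j S none plan = step (improve τ-noRepeat S)
        where
        step : Improves τ-noRepeat S → Plan (suc j) B S
        step (ps , len≤ , runs , u′≤) = append (plan (S ∪ setOf (concat ps)))
          where
          S′ : Subset n
          S′ = S ∪ setOf (concat ps)
          append : Plan j (β * B) S′ → Plan (suc j) B S
          append (σ , σ∋ , σ≤) = concat ps ++ σ , (λ v → ∈-++⁺ʳ (concat ps) (σ∋ v)) , (begin
            costL root S (concat ps ++ σ)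
              ≤⟨ costL-blocks S ps σ 0≤B (All.map run-len runs) ⟩
            ι (length ps) * (2ℚ * B * u S) + costL root S′ σ
              ≤⟨ +-mono-≤ (*-monoʳ-≤ (0≤2 ⊛ 0≤B ⊛ u-nonneg S) (ι-mono len≤)) σ≤ ⟩
            ι (rounds ℕ.+ suc rounds) * (2ℚ * B * u S) + (16ℚ * K * (β * B) * u S′ + 20ℚ * K * G j (β * B))
              ≡⟨ cong (_+ (16ℚ * K * (β * B) * u S′ + 20ℚ * K * G j (β * B)))
                   (reassoc (ι (rounds ℕ.+ suc rounds)) 2ℚ B (u S)) ⟩
            K * B * u S + (16ℚ * K * (β * B) * u S′ + 20ℚ * K * G j (β * B))
              ≤⟨ ≤-by (0≤20 ⊛ 0≤K ⊛ 0≤B ⊛ diff≥0 u′≤ ⊕ 0≤20 ⊛ 0≤K ⊛ 0≤B ⊛ diff≥0 (q-bound none))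
                   (phase-arith K B (u S) (u S′) (q τ-noRepeat) (E dist late) (G j (β * B))) ⟩
            16ℚ * K * B * u S + 20ℚ * K * (B * E dist late + G j (β * B))
              ≡⟨ cong (λ z → 16ℚ * K * B * u S + 20ℚ * K * z) G-suc ⟨
            16ℚ * K * B * u S + 20ℚ * K * G (suc j) B ∎)
            where
            open ≤-Reasoning
            reassoc : ∀ i t b u → i * (t * b * u) ≡ i * t * b * u
            reassoc = solve-∀ ℚ-ring
            G-suc : G (suc j) B ≡ B * E dist late + G j (β * B)
            G-suc = trans (E-+ dist (λ r → B * late r) (λ r → geo j (β * B) (ℓ r)))
              (cong (_+ G j (β * B)) (E-* dist B late))

    opaque
      -- If the cut tree visits all vertices with positive probability, such a run is a full tour
      -- within the budget and ends the plan. Otherwise `q-bound` applies and a round is played. The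
      -- last budget affords `allFin n`.
      build : ∀ j B S → 0ℚ ≤ B → len root (allFin n) ≤ B * β ^ j → Plan j B S
      build zero    B S 0≤B fin = visit-all 0 S (allFin n) 0≤B ∈-allFin (subst (len root (allFin n) ≤_) (*-identityʳ B) fin)
      build (suc j) B S 0≤B fin = go (E dist completes ≤? 0ℚ)
        where
        open Phase B 0≤B
        go : Dec (E dist completes ≤ 0ℚ) → Plan (suc j) B S
        go (yes none) = next j S none λ S′ → build j (β * B) S′ (0≤β ⊛ 0≤B)
          (subst (len root (allFin n) ≤_) (reassoc B β (β ^ j)) fin)
          where
          reassoc : ∀ b c t → b * (c * t) ≡ (c * b) * t
          reassoc = solve-∀ ℚ-ring
        go (no some) = pick (E-attains-≥ pr completes)
          where
          pick : (∃ λ r → Supp dist r × E dist completes ≤ completes r) → Plan (suc j) B S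
          pick (r , _ , le) with full? (setOf (run τ r))
          ... | yes full = visit-all (suc j) S (run τ r) 0≤B (λ v → ∈-setOf⁻ (run τ r) (full v)) (run-len (r , refl))
          ... | no  _    = ⊥-elim (some le)

    plan : ∀ {η} → 0ℚ < η → ∃ λ σ → (∀ v → v ∈ σ) ×
      costL root ⊥ σ ≤ (16ℚ * K + 20ℚ * K * 5ℚ) * expCost I π + 16ℚ * K * η
    plan {η} 0<η = finish (enough-phases (len root (allFin n)) 0<b)
      where
      C b : ℚ
      C = expCost I π
      -- Starting at about the cost of `π` keeps the initial potential `O(C)`; the slack `η` makes
      -- the budget positive, as growth by `β` needs, even if `C` is zero.
      b = C + η
      0≤C : 0ℚ ≤ C
      0≤C = subst (0ℚ ≤_) (sym expCost≡Eℓ) (subst (_≤ E dist ℓ) (E-const pr 0ℚ)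
        (E-mono pr (λ r → len-nonneg root (run π′ r))))
      0<b : 0ℚ < b
      0<b = +-mono-≤-< 0≤C 0<η
      finish : (∃ λ j → len root (allFin n) ≤ b * β ^ j) → _
      finish (j , fin) with build j b ⊥ (<⇒≤ 0<b) fin
      ... | σ , σ∋ , σ≤ = σ , σ∋ , ≤-trans σ≤ (≤-by
        (0≤16 ⊛ 0≤K ⊛ <⇒≤ 0<b ⊛ diff≥0 (u≤1 ⊥) ⊕ 0≤20 ⊛ 0≤K ⊛ diff≥0 G≤)
        (lemma (16ℚ * K) (20ℚ * K) 5ℚ C η (u ⊥) (G j b)))
        where
        G≤ : G j b ≤ 5ℚ * C
        G≤ = subst (G j b ≤_) (trans (E-* dist 5ℚ ℓ) (cong (5ℚ *_) (sym expCost≡Eℓ)))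
          (E-mono pr (λ r → geo-bound j (<⇒≤ 0<b) (len-nonneg root (run π′ r))))
        lemma : ∀ k l f c e u g → (k + l * f) * c + k * e ≡
          (k * (c + e) * u + l * g) + (k * (c + e) * (1ℚ - u) + l * (f * c - g))
        lemma = solve-∀ ℚ-ring

-- Cost of a fixed order.

module _ {n} (I : Instance n) where
  open Instance I
  open IsMetric isMetric
  open Tours I

  nonAdaptive-noRepeat : ∀ S acc σ → Distinct S σ → NoRepeat S (nonAdaptiveFrom I acc σ)
  nonAdaptive-noRepeat S acc []      _         = tt
  nonAdaptive-noRepeat S acc (v ∷ σ) (v∉S , δ) with k ℕ.≤? acc
  ... | yes _ = tt
  ... | no  _ = v∉S , λ a → nonAdaptive-noRepeat (S [ v ]≔ true) (acc ℕ.+ a) σ δ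

  runCost : Fin n → Subset n → List (Fin n) → Vec ℕ n → ℚ
  runCost cur S []      r = 0ℚ
  runCost cur S (v ∷ σ) r = d cur v * short S r + runCost v (S [ v ]≔ true) σ r

  runCost-nonneg : ∀ cur S σ r → 0ℚ ≤ runCost cur S σ r
  runCost-nonneg cur S []      r = ≤-refl
  runCost-nonneg cur S (v ∷ σ) r =
    nonneg cur v ⊛ ⟦⟧-nonneg (sumS S r ℕ.<? k) ⊕ runCost-nonneg v (S [ v ]≔ true) σ r

  len-nonAdaptive : ∀ cur {S acc} σ r → Distinct S σ → acc ≡ sumS S r →
    len cur (run (nonAdaptiveFrom I acc σ) r) ≤ runCost cur S σ r
  len-nonAdaptive cur []      r _         acc≡ = ≤-refl
  len-nonAdaptive cur {S} {acc} (v ∷ σ) r (v∉S , δ) acc≡ with k ℕ.≤? acc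
  ... | yes _     = runCost-nonneg cur S (v ∷ σ) r
  ... | no  k≰acc = +-mono-≤ (≤-reflexive (sym (trans (cong (d cur v *_) short≡1) (*-identityʳ (d cur v)))))
    (len-nonAdaptive v σ r δ (trans (cong (ℕ._+ lookup r v) acc≡) (sym (sumS-insert S v r v∉S))))
    where
    short≡1 : short S r ≡ 1ℚ
    short≡1 = ⟦⟧-true (sumS S r ℕ.<? k) (subst (ℕ._< k) acc≡ (ℕₚ.≰⇒> k≰acc))

  E-runCost : ∀ cur S σ → E dist (runCost cur S σ) ≡ costL cur S σ
  E-runCost cur S []      = E-const pr 0ℚ
  E-runCost cur S (v ∷ σ) = trans (E-+ dist (λ r → d cur v * short S r) (runCost v (S [ v ]≔ true) σ))
    (cong₂ _+_ (E-* dist (d cur v) (short S)) (E-runCost v (S [ v ]≔ true) σ))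

  expCost-nonAdaptive : ∀ σ → Distinct ⊥ σ → expCost I (nonAdaptive I σ) ≤ costL root ⊥ σ
  expCost-nonAdaptive σ δ = subst₂ _≤_
    (sym (expCost-run root (nonAdaptive I σ) (nonAdaptive-noRepeat ⊥ 0 σ δ)))
    (E-runCost root ⊥ σ)
    (E-mono pr λ r → len-nonAdaptive root σ r δ (sym (sumS-⊥ r)))

-- Exhaustive search over tours.

words : ∀ {A : Set} → List A → ℕ → List (List A)
words xs zero    = [] ∷ []
words xs (suc m) = cartesianProductWith _∷_ xs (words xs m)

∈-words : ∀ {A : Set} {xs : List A} (σ : List A) → (∀ v → v ∈ σ → v ∈ xs) → σ ∈ words xs (length σ)
∈-words []      h = here refl
∈-words (v ∷ σ) h = ∈-cartesianProductWith⁺ _∷_ (h v (here refl)) (∈-words σ (λ w → h w ∘ there))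

IsTour : ∀ {n} → List (Fin n) → Set
IsTour σ = Unique σ × (∀ v → v ∈ σ)

isTour? : ∀ {n} (σ : List (Fin n)) → Dec (IsTour σ)
isTour? σ = DecUnique.unique? Finₚ._≟_ σ ×-dec Finₚ.all? (λ v → DecMembership._∈?_ Finₚ._≟_ v σ)

tours : ∀ n → List (List (Fin n))
tours n = filter isTour? (words (allFin n) n)

-- Duplicate-free lists with the same members are permutations of each other, here `σ` and
-- `allFin n`.
tour-length : ∀ {n} (σ : List (Fin n)) → IsTour σ → length σ ≡ n
tour-length {n} σ (uniq , σ∋) = trans
  (↭-length (∼bag⇒↭ (unique∧set⇒bag uniq (allFin⁺ n) (λ {v} → mk⇔ (λ _ → ∈-allFin v) (λ _ → σ∋ v)))))
  (Listₚ.length-tabulate (λ v → v))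

∈-tours : ∀ {n} (σ : List (Fin n)) → IsTour σ → σ ∈ tours n
∈-tours {n} σ tour = ∈-filter⁺ isTour?
  (subst (λ m → σ ∈ words (allFin n) m) (tour-length σ tour) (∈-words σ (λ v _ → ∈-allFin v))) tour

bestTour : ∀ {n} → Instance n → List (Fin n)
bestTour {n} I = argmin (λ σ → expCost I (nonAdaptive I σ)) (allFin n) (tours n)

bestTour-isTour : ∀ {n} (I : Instance n) → IsTour (bestTour I)
bestTour-isTour {n} I = argmin-all (λ σ → expCost I (nonAdaptive I σ)) (allFin⁺ n , ∈-allFin)
  (Allₚ.all-filter isTour? (words (allFin n) n))

bestTour-optimal : ∀ {n} (I : Instance n) σ → IsTour σ →
  expCost I (nonAdaptive I (bestTour I)) ≤ expCost I (nonAdaptive I σ)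
bestTour-optimal {n} I σ tour = All.lookup
  (f[argmin]≤f[xs] {f = λ σ → expCost I (nonAdaptive I σ)} (allFin n) (tours n)) (∈-tours σ tour)

-- Finitely many orders compete, so a slack η in the bound can be removed by letting η → 0.
≤-of-slack : ∀ {x y m} → 0ℚ < m → (∀ {η} → 0ℚ < η → x ≤ y + m * η) → x ≤ y
≤-of-slack {x} {y} {m} 0<m h = go (x ≤? y)
  where
  nz : NonZero m
  nz = pos⇒nonZero m {{positive 0<m}}
  go : Dec (x ≤ y) → x ≤ y
  go (yes x≤y) = x≤y
  go (no  x≰y) = ≤-by (diff≥0 step ⊕ diff≥0 step) (lemma x y)
    where
    0<x-y : 0ℚ < x - y
    0<x-y = subst (_< x - y) (+-inverseʳ y) (+-monoˡ-< (- y) (≰⇒> x≰y))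
    η : ℚ
    η = ½ * (x - y) * (1/ m) {{nz}}
    0<η : 0ℚ < η
    0<η = positive⁻¹ η {{pos*pos⇒pos (½ * (x - y)) {{pos*pos⇒pos ½ (x - y) {{positive 0<x-y}}}}
      ((1/ m) {{nz}}) {{1/pos⇒pos m {{positive 0<m}}}}}}
    mη : m * η ≡ ½ * (x - y)
    mη = trans (*-comm m η) (trans (*-assoc (½ * (x - y)) ((1/ m) {{nz}}) m)
      (trans (cong (½ * (x - y) *_) (*-inverseˡ m {{nz}})) (*-identityʳ (½ * (x - y)))))
    step : x ≤ y + ½ * (x - y)
    step = subst (λ z → x ≤ y + z) mη (h 0<η)
    lemma : ∀ x y → y ≡ x + ((y + ½ * (x - y) - x) + (y + ½ * (x - y) - x))
    lemma = solve-∀ ℚ-ring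

K>0 : 0ℚ < 16ℚ * K
K>0 = <-≤-trans 0<2 2≤16K

theorem1p1 : Σ ℚ λ c → Σ ({n : ℕ} → Instance n → List (Fin n)) λ alg →
    ∀ (n : ℕ) (I : Instance n) →
    Unique (alg I) × (∀ v → v ∈ alg I) ×
    (∀ (π : Policy n) → ValidPolicy I π →
    expCost I (nonAdaptive I (alg I)) ≤ c * expCost I π)
theorem1p1 = 16ℚ * K + 20ℚ * K * 5ℚ , bestTour , λ n I →
  proj₁ (bestTour-isTour I) , proj₂ (bestTour-isTour I) , λ π valid →
  ≤-of-slack K>0 (λ {η} 0<η → bound I π valid (Tours.plan I π valid 0<η))
  where
  bound : ∀ {n η} (I : Instance n) π (valid : ValidPolicy I π) → (∃ λ σ → (∀ v → v ∈ σ) ×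
      Tours.costL I (Instance.root I) ⊥ σ ≤ (16ℚ * K + 20ℚ * K * 5ℚ) * expCost I π + 16ℚ * K * η) →
    expCost I (nonAdaptive I (bestTour I)) ≤ (16ℚ * K + 20ℚ * K * 5ℚ) * expCost I π + 16ℚ * K * η
  -- The planned walk may repeat vertices; `dedup` makes it a competing tour without raising
  -- `costL`.
  bound I π valid (σ , σ∋ , σ≤) = ≤-trans (bestTour-optimal I (dedup ⊥ σ) (proj₂ (distinct-unique ⊥ (dedup ⊥ σ) δ) , covers))
    (≤-trans (expCost-nonAdaptive I (dedup ⊥ σ) δ) (≤-trans (Tours.costL-dedup I (Instance.root I) ⊥ σ) σ≤))
    where
    δ = dedup-distinct ⊥ σ
    covers : ∀ v → v ∈ dedup ⊥ σ
    covers v with dedup-∈ ⊥ σ (σ∋ v)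
    ... | inj₁ h = case trans (sym (lookup-⊥ v)) h of λ ()
    ... | inj₂ v∈ = v∈
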